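{- Let $G$ be the $(n\times n)$-grid. Then for every $Q\subseteq V_1$, with $p=|Q|$, it holds that $\delta(Q)\ge\min(\delta(Z_p),\delta(Z'_p))$.
   Context: The $(n\times n)$-grid $G$ has vertex set $\{(x,y): x,y\in\mathbb Z,\ 1\le x,y\le n\}$, with $(x,y)$ adjacent to $(x',y')$ iff $|x-x'|+|y-y'|=1$. $V_1=\{(x,y): x+y \text{ even}\}$. For $S\subseteq V(G)$, $N(S)=\bigcup_{v\in S}N(v)\setminus S$ and $\delta(S)=|N(S)|$. For an integer $i$, $U_i=\{(x,y)\in V(G):x+y=i\}$ and $W_i=\{(x,y)\in V(G):x-y=i\}$. Let $v_1,\ldots,v_{\lceil n^2/2\rceil}$ be the ordering of $V_1$ that lists consecutively the vertices of $U_2,U_4,\ldots,U_{2n}$, the vertices within each $U_i$ listed in increasing order of $y$-coordinate; $Z_p=\{v_1,\ldots,v_p\}$. Let $v'_1,\ldots,v'_{\lceil n^2/2\rceil}$ be the ordering of $V_1$ that lists consecutively the vertices of $W_{2\lceil n/2\rceil-2},W_{2\lceil n/2\rceil-4},\ldots,W_{2-2\lceil n/2\rceil}$, the vertices within each $W_i$ listed in increasing order of $y$-coordinate; $Z'_p=\{v'_1,\ldots,v'_p\}$ (with $Z_0=Z'_0=\emptyset$). -}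

module Defs where

open import Data.Nat using (ℕ; zero; suc; _+_; _*_; _∸_; _≡ᵇ_; ∣_-_∣; _/_; _%_)
open import Data.Fin using (Fin; toℕ)
open import Data.Fin.Properties using () renaming (_≟_ to _≟ᶠ_)
open import Data.Bool using (Bool; true; false; not; _∧_; _∨_; if_then_else_)
open import Data.List using (List; []; _∷_; concatMap; filterᵇ; take; length; map; upTo; allFin)
open import Data.Bool.ListAction using (any)
open import Data.Product using (_×_; _,_; proj₁; proj₂)
open import Relation.Nullary.Decidable using (⌊_⌋)

-- A vertex of the (n × n)-grid: (i , j) : Fin n × Fin n stands for the
-- grid point (x , y) = (toℕ i + 1 , toℕ j + 1).
Vertex : ℕ → Set
Vertex n = Fin n × Fin n

xc : ∀ {n} → Vertex n → ℕ
xc (i , _) = suc (toℕ i)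

yc : ∀ {n} → Vertex n → ℕ
yc (_ , j) = suc (toℕ j)

_==_ : ∀ {n} → Vertex n → Vertex n → Bool
(i , j) == (i' , j') = ⌊ i ≟ᶠ i' ⌋ ∧ ⌊ j ≟ᶠ j' ⌋

adj : ∀ {n} → Vertex n → Vertex n → Bool
adj u v = (∣ xc u - xc v ∣ + ∣ yc u - yc v ∣) ≡ᵇ 1

-- all vertices, listed in increasing order of y (and, for equal y, of x)
vertices : ∀ n → List (Vertex n)
vertices n = concatMap (λ j → map (λ i → (i , j)) (allFin n)) (allFin n)

inV1 : ∀ {n} → Vertex n → Bool
inV1 v = ((xc v + yc v) % 2) ≡ᵇ 0

Subset : ℕ → Set
Subset n = Vertex n → Bool

card : ∀ {n} → Subset n → ℕ
card {n} S = length (filterᵇ S (vertices n))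

inN : ∀ {n} → Subset n → Subset n
inN {n} S v = not (S v) ∧ any (λ u → S u ∧ adj u v) (vertices n)

δ : ∀ {n} → Subset n → ℕ
δ S = card (inN S)

-- U_i = { x + y = i } ,  vertices listed in increasing order of y
U : ∀ n → ℕ → List (Vertex n)
U n i = filterᵇ (λ v → (xc v + yc v) ≡ᵇ i) (vertices n)

order : ∀ n → List (Vertex n)
order n = concatMap (λ k → U n (2 * suc k)) (upTo n)

ceilHalf : ℕ → ℕ
ceilHalf n = (n + 1) / 2

-- W_i for i = 2c - 2 - 2k (c = ⌈n/2⌉):  x - y = 2c - 2 - 2k  ⇔  x + 2k + 2 = y + 2c
Wk : ∀ n → ℕ → List (Vertex n)
Wk n k = filterᵇ (λ v → (xc v + 2 * k + 2) ≡ᵇ (yc v + 2 * ceilHalf n)) (vertices n)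

-- ordering v'₁ , v'₂ , … of V₁ : W_{2c-2} , W_{2c-4} , … , W_{2-2c}
-- (k = 0 , 1 , … , 2c - 2, i.e. the first 2c - 1 values of k)
order' : ∀ n → List (Vertex n)
order' n = concatMap (Wk n) (upTo (2 * ceilHalf n ∸ 1))

fromList : ∀ {n} → List (Vertex n) → Subset n
fromList xs v = any (λ u → u == v) xs

Z : ∀ n → ℕ → Subset n
Z n p = fromList (take p (order n))

Z' : ∀ n → ℕ → Subset n
Z' n p = fromList (take p (order' n))

-- Cut the grid into antidiagonals and, starting from a corner, let q k and m k be the numbers of
-- vertices of Q and of N(Q) on the successive even and odd antidiagonals, M k and κ k the numbers of
-- vertices there outside Q and N(Q).  While antidiagonals grow, q k > 0 forces m k > q k and, dually,
-- κ k > 0 forces M (k+1) > κ k; the other half of the grid gives the same from the opposite corner.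
-- Let g = ∑ m - ∑ q over an initial segment.  Moving towards the middle, the last extreme event is
-- either an empty diagonal (q k = 0), after which ∑ q ≤ α² + γ(γ-1)/2 with g = α + γ and q k ≤ γ,
-- or a full one (κ k = 0), after which the same kind of bound holds for ∑ κ.  Gluing the two halves
-- with p = |Q| and g = δ(Q) - p: if both end in the first kind, p ≤ g²; if both end in the second, the
-- complement has at most g(g+1) (n even) or (g+1)² (n odd) vertices; if the kinds differ, g ≥ ⌊n/2⌋.
-- In the first and third case, and in the second for odd n, δ(Z p) ≤ p + g; in the second for
-- even n, δ(Z' p) ≤ p + g.
{-# OPTIONS --safe #-}
module Submission where

open import Defs
open import Data.Nat
open import Data.Bool using (Bool; true; false; not; _∧_; T)
open import Data.Bool.ListAction using (any)
open import Data.Bool.Properties using (T?; T-≡; T-∧; not-involutive; ¬-not)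
open import Data.Fin as Fin using (Fin; toℕ; fromℕ<)
open import Data.Fin.Properties using (toℕ-fromℕ<; toℕ-injective; toℕ≤pred[n]) renaming (_≟_ to _≟ᶠ_)
open import Data.List using (List; []; _∷_; _++_; allFin; applyUpTo; concatMap; filterᵇ; length; map; tabulate; take; upTo)
open import Data.List.Membership.Propositional using (_∈_; find; lose)
open import Data.List.Membership.Propositional.Properties using (∈-allFin; ∈-concatMap⁺; ∈-filter⁺; ∈-filter⁻; ∈-map⁺; ∈-map⁻)
open import Data.List.Properties using (filter-++; length-++)
open import Data.List.Relation.Unary.Any using (here; there)
open import Data.List.Relation.Unary.Any.Properties using (any⁺; any⁻)
open import Data.Nat.DivMod using (m/n≡1+[m∸n]/n)
open import Data.Nat.Properties
open import Data.Nat.Tactic.RingSolver using (solve-∀)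
open import Data.Product using (_×_; _,_; ∃; ∃₂; proj₁; proj₂)
open import Data.Sum using (_⊎_; inj₁; inj₂; swap)
open import Function using (_∘_; flip; id; Equivalence)
open import Relation.Binary.Definitions using (tri<; tri≈; tri>)
open import Relation.Binary.PropositionalEquality
open import Relation.Nullary using (yes; no; contradiction)
open import Relation.Nullary.Decidable using (toWitness; ⌊_⌋)

-- Accumulated bounds along a chain of growing diagonals

-- The obstacle is the gluing. Joining surpluses g and g′ over a shared diagonal of q vertices
-- leaves only g + g′ - q, and the bound q ≤ 2g + 1, all that holds from the corner on, would let
-- that vanish. Growth of the complement repairs this: it always gives q (k+1) ≤ m k + 1, and q
-- (k+1) ≤ m k as soon as κ k > 0. This gain of one keeps q k ≤ γ after an empty diagonal, at the
-- price of splitting g into the α earned before that diagonal and the γ earned since. On gluing, α²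
-- and α′² fit into (α + α′)², and the two triangles γ(γ-1)/2 combine into a square. A full diagonal
-- (κ k = 0) ends the bound for Q but starts the one for the complement, and vice versa. The shapes
-- g², g(g+1) and (g+1)² are those of corner regions of V₁: diagonals of sizes 1, 3, 5, ... at a
-- corner in V₁, and 2, 4, 6, ... at a corner outside V₁. For even n the corners (1, n) and (n, 1)
-- lie outside V₁, which is where Z′ enters; for odd n all four corners lie in V₁.

∑ : (ℕ → ℕ) → ℕ → ℕ
∑ f zero = 0
∑ f (suc n) = ∑ f n + f n

dbl : ℕ → ℕ
dbl zero = 0
dbl (suc k) = suc (suc (dbl k))

dbl≡ : ∀ k → dbl k ≡ k + k
dbl≡ zero = refl
dbl≡ (suc k) = cong suc (trans (cong suc (dbl≡ k)) (sym (+-suc k k)))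

∑-+ : ∀ f g n → ∑ (λ k → f k + g k) n ≡ ∑ f n + ∑ g n
∑-+ f g zero = refl
∑-+ f g (suc n) = trans (cong (_+ (f n + g n)) (∑-+ f g n)) (interchange (∑ f n) (∑ g n) (f n) (g n))
  where
  interchange : ∀ a b c d → a + b + (c + d) ≡ a + c + (b + d)
  interchange = solve-∀

∑-odd : ∀ n → ∑ (λ k → suc (dbl k)) n ≡ n * n
∑-odd zero = refl
∑-odd (suc n) rewrite ∑-odd n | dbl≡ n = lem n
  where
  lem : ∀ n → n * n + suc (n + n) ≡ suc n * suc n
  lem = solve-∀

∑-even : ∀ n → ∑ (λ k → suc (suc (dbl k))) n ≡ n * n + n
∑-even zero = refl
∑-even (suc n) rewrite ∑-even n | dbl≡ n = lem n
  where
  lem : ∀ n → n * n + n + suc (suc (n + n)) ≡ suc n * suc n + suc n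
  lem = solve-∀

∑-cong : ∀ {f g} n → (∀ k → k < n → f k ≡ g k) → ∑ f n ≡ ∑ g n
∑-cong zero h = refl
∑-cong (suc n) h = cong₂ _+_ (∑-cong n (λ k k<n → h k (m<n⇒m<1+n k<n))) (h n ≤-refl)

-- The sum stops before its argument: `△ γ` is γ(γ-1)/2, and `△ (suc γ)` adds exactly γ, the largest
-- size allowed for the next diagonal.
△ : ℕ → ℕ
△ = ∑ (λ k → k)

△-mono : ∀ a d → △ a ≤ △ (a + d)
△-mono a zero rewrite +-identityʳ a = ≤-refl
△-mono a (suc d) rewrite +-suc a d = ≤-trans (△-mono a d) (m≤m+n _ _)

△+△ : ∀ x → △ x + △ x + x ≡ x * x
△+△ zero = refl
△+△ (suc x) = trans (lem₁ (△ x) x) (trans (cong (_+ suc (x + x)) (△+△ x)) (lem₂ x))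
  where
  lem₁ : ∀ t x → t + x + (t + x) + suc x ≡ t + t + x + suc (x + x)
  lem₁ = solve-∀
  lem₂ : ∀ x → x * x + suc (x + x) ≡ suc x * suc x
  lem₂ = solve-∀

Grow : ℕ → ℕ → Set
Grow a b = a ≡ 0 ⊎ a < b

Grow⇒≤ : ∀ {a b} → Grow a b → a ≤ b
Grow⇒≤ (inj₁ refl) = z≤n
Grow⇒≤ (inj₂ lt) = <⇒≤ lt

∃+ : ∀ {m n} → m ≤ n → ∃ λ d → n ≡ m + d
∃+ {m} {n} le = n ∸ m , sym (m+[n∸m]≡n le)

≤-by : ∀ {a b} c → a + c ≡ b → a ≤ b
≤-by c refl = m≤m+n _ c

-- The bounds below concern P = ∑ q and O = ∑ m up to some diagonal, q being the next diagonal.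
record SquareBound (P O q : ℕ) : Set where
  constructor mkSquare
  field
    g : ℕ
    O≡ : O ≡ P + g
    P≤ : P ≤ g * g
    q≤ : q ≤ suc (g + g)

-- The sharper form available in the dual chain, which starts with an M rather than a q.
record OblongBound (P O q : ℕ) : Set where
  constructor mkOblong
  field
    g : ℕ
    O≡ : O ≡ P + g
    P≤ : P + g ≤ g * g
    q≤ : q ≤ g + g

-- State after an empty diagonal: α is the value of O ∸ P there, γ the increase since.
-- The primal chain uses e = 0 and the dual one e = 1.
record SplitBound (e P O q : ℕ) : Set where
  constructor mkSplit
  field
    α γ : ℕ
    O≡ : O ≡ P + (α + γ)
    P≤ : P + e * α ≤ α * α + △ γ
    q≤ : q ≤ γ

-- A nonempty diagonal raises g by m - q ≥ 1, and the passage from g² to (g + 1)² pays for its at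
-- most 2g + 1 vertices.
SquareBound-step : ∀ {P O q m q′} → Grow q m → q′ ≤ suc m → SquareBound P O q → SquareBound (P + q) (O + m) q′
SquareBound-step {P} {O} {q} {m} (inj₁ refl) q′≤ (mkSquare g refl P≤ q≤) =
  mkSquare (g + m) (lem₁ P g m)
    (≤-trans (≤-reflexive (+-identityʳ P)) (≤-trans P≤ (≤-by (g * m + g * m + m * m) (lem₂ g m))))
    (≤-trans q′≤ (s≤s (≤-by (g + g + m) (lem₃ g m))))
  where
  lem₁ : ∀ P g m → P + g + m ≡ P + 0 + (g + m)
  lem₁ = solve-∀
  lem₂ : ∀ g m → g * g + (g * m + g * m + m * m) ≡ (g + m) * (g + m)
  lem₂ = solve-∀
  lem₃ : ∀ g m → m + (g + g + m) ≡ g + m + (g + m)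
  lem₃ = solve-∀
SquareBound-step {P} {O} {q} (inj₂ q<m) q′≤ (mkSquare g refl P≤ q≤) with ∃+ q<m
... | d , refl =
  mkSquare (g + suc d) (lem₁ P g q d)
    (≤-trans (+-mono-≤ P≤ q≤) (≤-by (g * d + g * d + d * d + d + d) (lem₂ g d)))
    (≤-trans q′≤ (≤-trans (s≤s (s≤s (+-monoˡ-≤ d q≤))) (≤-by d (lem₃ g d))))
  where
  lem₁ : ∀ P g q d → P + g + (suc q + d) ≡ P + q + (g + suc d)
  lem₁ = solve-∀
  lem₂ : ∀ g d → g * g + suc (g + g) + (g * d + g * d + d * d + d + d) ≡ (g + suc d) * (g + suc d)
  lem₂ = solve-∀
  lem₃ : ∀ g d → suc (suc (suc (g + g) + d)) + d ≡ suc (g + suc d + (g + suc d))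
  lem₃ = solve-∀

-- With `q′ ≤ suc m` alone the bound q ≤ 2g would break at g = m = 0; this is why that alternative
-- comes with `0 < m`.
OblongBound-step : ∀ {P O q m q′} → Grow q m → Grow q′ m ⊎ (q′ ≤ suc m × 0 < m) → OblongBound P O q → OblongBound (P + q) (O + m) q′
OblongBound-step {P} {O} {q} {m} {q′} (inj₁ refl) h (mkOblong g refl P≤ q≤) =
  mkOblong (g + m) (lem₁ P g m)
    (≤-trans (≤-reflexive (lem₂ P g m)) (≤-trans (+-mono-≤ P≤ (m≤m*m m)) (≤-by (g * m + g * m) (lem₃ g m))))
    (bound h)
  where
  m≤m*m : ∀ m → m ≤ m * m
  m≤m*m zero = z≤n
  m≤m*m (suc m) = m≤m+n (suc m) _
  lem₁ : ∀ P g m → P + g + m ≡ P + 0 + (g + m)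
  lem₁ = solve-∀
  lem₂ : ∀ P g m → P + 0 + (g + m) ≡ P + g + m
  lem₂ = solve-∀
  lem₃ : ∀ g m → g * g + m * m + (g * m + g * m) ≡ (g + m) * (g + m)
  lem₃ = solve-∀
  lem₄ : ∀ g m → m + (g + m + g) ≡ g + m + (g + m)
  lem₄ = solve-∀
  bound : Grow q′ m ⊎ (q′ ≤ suc m × 0 < m) → q′ ≤ g + m + (g + m)
  bound (inj₁ gr) = ≤-trans (Grow⇒≤ gr) (≤-by (g + m + g) (lem₄ g m))
  bound (inj₂ (le , 0<m)) = ≤-trans le (≤-trans (+-monoˡ-≤ m 0<m)
    (+-mono-≤ (m≤n+m m g) (m≤n+m m g)))
OblongBound-step {P} {O} {q} {m} {q′} (inj₂ q<m) h (mkOblong g refl P≤ q≤) with ∃+ q<m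
... | d , refl =
  mkOblong (g + suc d) (lem₁ P g q d)
    (≤-trans (≤-reflexive (lem₂ P g q d)) (≤-trans (+-monoˡ-≤ (suc d) (+-mono-≤ P≤ q≤))
      (≤-by (g * d + g * d + d * d + d) (lem₃ g d))))
    (≤-trans (bound h) (≤-trans (s≤s (s≤s (+-monoˡ-≤ d q≤))) (≤-by d (lem₄ g d))))
  where
  bound : Grow q′ (suc q + d) ⊎ (q′ ≤ suc (suc q + d) × 0 < suc q + d) → q′ ≤ suc (suc (q + d))
  bound (inj₁ gr) = ≤-trans (Grow⇒≤ gr) (n≤1+n _)
  bound (inj₂ (le , _)) = le
  lem₁ : ∀ P g q d → P + g + (suc q + d) ≡ P + q + (g + suc d)
  lem₁ = solve-∀
  lem₂ : ∀ P g q d → P + q + (g + suc d) ≡ P + g + q + suc d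
  lem₂ = solve-∀
  lem₃ : ∀ g d → g * g + (g + g) + suc d + (g * d + g * d + d * d + d) ≡ (g + suc d) * (g + suc d)
  lem₃ = solve-∀
  lem₄ : ∀ g d → suc (suc (g + g + d)) + d ≡ g + suc d + (g + suc d)
  lem₄ = solve-∀

-- α stays frozen and γ absorbs m - q. Having `q′ ≤ m` rather than `suc m` preserves q ≤ γ, and
-- `△ (suc γ)` pays for the q ≤ γ new points.
SplitBound-step : ∀ {e P O q m q′} → Grow q m → q′ ≤ m → SplitBound e P O q → SplitBound e (P + q) (O + m) q′
SplitBound-step {e} {P} {O} {q} {m} (inj₁ refl) q′≤ (mkSplit α γ refl P≤ q≤) =
  mkSplit α (γ + m) (lem₁ P α γ m)
    (≤-trans (≤-reflexive (cong (_+ e * α) (+-identityʳ P))) (≤-trans P≤ (+-monoʳ-≤ (α * α) (△-mono γ m))))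
    (≤-trans q′≤ (m≤n+m m γ))
  where
  lem₁ : ∀ P α γ m → P + (α + γ) + m ≡ P + 0 + (α + (γ + m))
  lem₁ = solve-∀
SplitBound-step {e} {P} {O} {q} (inj₂ q<m) q′≤ (mkSplit α γ refl P≤ q≤) with ∃+ q<m
... | d , refl =
  mkSplit α (suc γ + d) (lem₁ P α γ q d)
    (≤-trans (≤-reflexive (lem₂ P q (e * α))) (≤-trans (+-mono-≤ P≤ q≤)
      (≤-trans (≤-reflexive (+-assoc (α * α) (△ γ) γ)) (+-monoʳ-≤ (α * α) (△-mono (suc γ) d)))))
    (≤-trans q′≤ (s≤s (+-monoˡ-≤ d q≤)))
  where
  lem₁ : ∀ P α γ q d → P + (α + γ) + (suc q + d) ≡ P + q + (α + (suc γ + d))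
  lem₁ = solve-∀
  lem₂ : ∀ P q x → P + q + x ≡ P + x + q
  lem₂ = solve-∀

SquareBound⇒SplitBound : ∀ {P O q} → SquareBound P O q → SplitBound 0 P O 0
SquareBound⇒SplitBound {P} (mkSquare g refl P≤ _) = mkSplit g 0 (cong (P +_) (sym (+-identityʳ g))) (+-mono-≤ P≤ z≤n) z≤n

OblongBound⇒SplitBound : ∀ {P O q} → OblongBound P O q → SplitBound 1 P O 0
OblongBound⇒SplitBound {P} (mkOblong g refl P≤ _) = mkSplit g 0 (cong (P +_) (sym (+-identityʳ g)))
  (≤-trans (≤-reflexive (cong (P +_) (*-identityˡ g))) (≤-trans P≤ (m≤m+n _ _))) z≤n

-- Gluing two chains at the middle diagonal

sq-sum₃ : ∀ a b c → a * a + b * b + c * c ≤ (a + b + c) * (a + b + c)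
sq-sum₃ a b c = ≤-by (2 * (a * b + a * c + b * c)) (lem a b c)
  where
  lem : ∀ a b c → a * a + b * b + c * c + 2 * (a * b + a * c + b * c) ≡ (a + b + c) * (a + b + c)
  lem = solve-∀

-- x = a + b - q is at least a and at least b, and two triangles `△ x` together with x make up x².
△+△≤ : ∀ {a b q} → q ≤ a → q ≤ b → ∃ λ x → a + b ≡ q + x × △ a + △ b + q ≤ x * x
△+△≤ {a} {b} {q} q≤a q≤b with ∃+ q≤a | ∃+ q≤b
... | d , refl | e , refl = q + d + e , lem₁ q d e ,
  ≤-trans (+-mono-≤ (+-mono-≤ (△-mono (q + d) e) (≤-trans (△-mono (q + e) d) (≤-reflexive (cong △ (lem₂ q d e)))))
            (≤-trans (m≤m+n q d) (m≤m+n _ e)))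
    (≤-reflexive (△+△ (q + d + e)))
  where
  lem₁ : ∀ q d e → q + d + (q + e) ≡ q + (q + d + e)
  lem₁ = solve-∀
  lem₂ : ∀ q d e → q + e + d ≡ q + d + e
  lem₂ = solve-∀

drop-e : ∀ {P x y} → P + x ≤ y → P ≤ y
drop-e {P} {x} = ≤-trans (m≤m+n P x)

-- The diagonal q lies ahead of both chains. Counting it once reduces the joint surplus to α + α′ +
-- x, where x = γ + γ′ - q.
merge-shared : ∀ {e P O P′ O′ q} → SplitBound e P O q → SplitBound e P′ O′ q →
  ∃ λ g → O + O′ ≡ P + P′ + q + g × P + P′ + q ≤ g * g
merge-shared {e} {P} {O} {P′} {O′} {q} (mkSplit α γ refl P≤ q≤) (mkSplit α′ γ′ refl P′≤ q≤′)
  with △+△≤ q≤ q≤′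
... | x , eq , TT = α + α′ + x ,
  trans (lem₁ P P′ α α′ γ γ′) (trans (cong (P + P′ + α + α′ +_) eq) (lem₂ P P′ α α′ q x)) ,
  ≤-trans (+-monoˡ-≤ q (+-mono-≤ (drop-e {P} P≤) (drop-e {P′} P′≤)))
    (≤-trans (≤-reflexive (lem₃ (α * α) (α′ * α′) (△ γ) (△ γ′) q))
      (≤-trans (+-monoʳ-≤ (α * α + α′ * α′) TT) (sq-sum₃ α α′ x)))
  where
  lem₁ : ∀ P P′ α α′ γ γ′ → P + (α + γ) + (P′ + (α′ + γ′)) ≡ P + P′ + α + α′ + (γ + γ′)
  lem₁ = solve-∀
  lem₂ : ∀ P P′ α α′ q x → P + P′ + α + α′ + (q + x) ≡ P + P′ + q + (α + α′ + x)
  lem₂ = solve-∀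
  lem₃ : ∀ a b t u q → a + t + (b + u) + q ≡ a + b + (t + u + q)
  lem₃ = solve-∀

e*≤ : ∀ {e} x → e ≤ 1 → e * x ≤ x
e*≤ x z≤n = z≤n
e*≤ x (s≤s z≤n) = ≤-reflexive (*-identityˡ x)

-- Here the shared diagonal m lies one step behind a and b. If a < m, write γ′ = b + w, x = γ + w
-- and m = a + 1 + d; the surplus is α + α′ + (x + 1 + d). Since x bounds γ, γ′, a and b, two
-- triangles and x fit into x², and the remaining 2x + 1 + d fit between x² and (x + 1 + d)².
merge-split≥ : ∀ {e P O P′ O′ a b m} → e ≤ 1 → b ≤ a → Grow a m → SplitBound e P O a → SplitBound e P′ O′ b →
  ∃ λ g → O + O′ + m ≡ P + a + (P′ + b) + g × P + a + (P′ + b) + e * g ≤ g * g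
merge-split≥ {e} {P} {O} {P′} {O′} {m = m} e≤1 z≤n (inj₁ refl) (mkSplit α γ refl P≤ _) (mkSplit α′ γ′ refl P′≤ _) =
  α + α′ + (γ + γ′ + m) , lem₁ P P′ α α′ γ γ′ m ,
  ≤-trans (≤-reflexive (lem₂ P P′ e α α′ (γ + γ′ + m)))
   (≤-trans (+-mono-≤ (+-mono-≤ P≤ P′≤) (e*≤ (γ + γ′ + m) e≤1))
    (≤-trans (≤-reflexive (lem₃ (α * α) (α′ * α′) (△ γ) (△ γ′) (γ + γ′ + m)))
     (≤-trans (+-monoʳ-≤ (α * α + α′ * α′) bound) (sq-sum₃ α α′ (γ + γ′ + m)))))
  where
  lem₁ : ∀ P P′ α α′ γ γ′ m → P + (α + γ) + (P′ + (α′ + γ′)) + m ≡ P + 0 + (P′ + 0) + (α + α′ + (γ + γ′ + m))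
  lem₁ = solve-∀
  lem₂ : ∀ P P′ e α α′ y → P + 0 + (P′ + 0) + e * (α + α′ + y) ≡ P + e * α + (P′ + e * α′) + e * y
  lem₂ = solve-∀
  lem₃ : ∀ a b t u y → a + t + (b + u) + y ≡ a + b + (t + u + y)
  lem₃ = solve-∀
  bound : △ γ + △ γ′ + (γ + γ′ + m) ≤ (γ + γ′ + m) * (γ + γ′ + m)
  bound = ≤-trans (+-monoˡ-≤ (γ + γ′ + m) (+-mono-≤
    (≤-trans (△-mono γ (γ′ + m)) (≤-reflexive (cong △ (sym (+-assoc γ γ′ m)))))
    (≤-trans (△-mono γ′ (γ + m)) (≤-reflexive (cong △ (lem γ γ′ m))))))
    (≤-reflexive (△+△ (γ + γ′ + m)))
    where
    lem : ∀ γ γ′ m → γ′ + (γ + m) ≡ γ + γ′ + m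
    lem = solve-∀
merge-split≥ {e} {P} {O} {P′} {O′} {a} {b} e≤1 b≤a (inj₂ a<m) (mkSplit α γ refl P≤ a≤) (mkSplit α′ γ′ refl P′≤ b≤)
  with ∃+ a<m | ∃+ b≤
... | d , refl | w , refl =
  α + α′ + suc (x + d) , lem₁ P P′ α α′ γ b w a d ,
  ≤-trans (≤-reflexive (lem₂ P P′ e α α′ (suc (x + d)) a b))
   (≤-trans (+-mono-≤ (+-mono-≤ (+-mono-≤ P≤ P′≤) (e*≤ (suc (x + d)) e≤1)) (+-mono-≤ a≤x b≤x))
    (≤-trans (≤-reflexive (lem₃ (α * α) (α′ * α′) (△ γ) (△ (b + w)) x d))
     (≤-trans (+-monoʳ-≤ (α * α + α′ * α′) bound) (sq-sum₃ α α′ (suc (x + d))))))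
  where
  x = γ + w
  a≤x : a ≤ x
  a≤x = ≤-trans a≤ (m≤m+n γ w)
  b≤x : b ≤ x
  b≤x = ≤-trans b≤a a≤x
  lem₁ : ∀ P P′ α α′ γ b w a d →
    P + (α + γ) + (P′ + (α′ + (b + w))) + (suc a + d) ≡ P + a + (P′ + b) + (α + α′ + suc (γ + w + d))
  lem₁ = solve-∀
  lem₂ : ∀ P P′ e α α′ y a b → P + a + (P′ + b) + e * (α + α′ + y) ≡ P + e * α + (P′ + e * α′) + e * y + (a + b)
  lem₂ = solve-∀
  lem₃ : ∀ a b t u x d → a + t + (b + u) + suc (x + d) + (x + x) ≡ a + b + (t + u + x + (suc (x + d) + x))
  lem₃ = solve-∀
  lem₄ : ∀ x d → x * x + (suc (x + d) + x) + (x * d + x * d + d * d + d) ≡ suc (x + d) * suc (x + d)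
  lem₄ = solve-∀
  bound : △ γ + △ (b + w) + x + (suc (x + d) + x) ≤ suc (x + d) * suc (x + d)
  bound with ∃+ (+-monoˡ-≤ w (≤-trans b≤a a≤))
  ... | v , eq = ≤-trans (+-monoˡ-≤ (suc (x + d) + x) (≤-trans (+-monoˡ-≤ x (+-mono-≤ (△-mono γ w)
      (≤-trans (△-mono (b + w) v) (≤-reflexive (cong △ (sym eq)))))) (≤-reflexive (△+△ x))))
    (≤-by (x * d + x * d + d * d + d) (lem₄ x d))

merge-split : ∀ {e P O P′ O′ a b m} → e ≤ 1 → Grow a m → Grow b m → SplitBound e P O a → SplitBound e P′ O′ b →
  ∃ λ g → O + O′ + m ≡ P + a + (P′ + b) + g × P + a + (P′ + b) + e * g ≤ g * g
merge-split {e} {P} {O} {P′} {O′} {a} {b} {m} e≤1 ga gb x y with ≤-total b a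
... | inj₁ b≤a = merge-split≥ e≤1 b≤a ga x y
... | inj₂ a≤b with merge-split≥ e≤1 a≤b gb y x
... | g , eq , le = g ,
  trans (cong (_+ m) (+-comm O O′)) (trans eq (cong (_+ g) (+-comm (P′ + b) (P + a)))) ,
  subst (λ z → z + e * g ≤ g * g) (+-comm (P′ + b) (P + a)) le

-- The two halves of the grid

record Chain : Set where
  field
    q m M κ : ℕ → ℕ
    qM : ∀ k → q k + M k ≡ suc (dbl k)
    mκ : ∀ k → m k + κ k ≡ suc (suc (dbl k))

compl-≤ : ∀ {a b c d} → a + b ≡ suc (c + d) → d < b → a ≤ c
compl-≤ {a} {b} {c} {d} eq d<b = +-cancelʳ-≤ b a c
  (≤-trans (≤-reflexive (trans eq (sym (+-suc c d)))) (+-monoʳ-≤ c d<b))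

compl-≤suc : ∀ {a b c d} → a + b ≡ suc (c + d) → d ≤ b → a ≤ suc c
compl-≤suc {a} {b} {c} {d} eq d≤b = +-cancelʳ-≤ b a (suc c)
  (≤-trans (≤-reflexive eq) (s≤s (+-monoʳ-≤ c d≤b)))

grow⇒< : ∀ {a b} → Grow a b → 0 < a → a < b
grow⇒< (inj₁ refl) ()
grow⇒< (inj₂ lt) _ = lt

module ChainProperties (c : Chain) where
  open Chain c

  Up Down : ℕ → Set
  Up k = Grow (q k) (m k)
  Down k = Grow (κ k) (M (suc k))

  mκ-qM : ∀ k → κ k + m k ≡ suc (M k + q k)
  mκ-qM k = trans (+-comm (κ k) (m k)) (trans (mκ k) (cong suc (trans (sym (qM k)) (+-comm (q k) (M k)))))

  qM-mκ : ∀ k → q (suc k) + M (suc k) ≡ suc (m k + κ k)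
  qM-mκ k = trans (qM (suc k)) (cong suc (sym (mκ k)))

  -- Supplies the side condition of `OblongBound-step`: if M k = 0, then Q fills its diagonal, so q
  -- k > 0, and strict growth leaves κ k = 0.
  κ-bound : ∀ k → Up k → Grow (κ k) (M k) ⊎ (κ k ≤ suc (M k) × 0 < M k)
  κ-bound k up with M k in eq
  ... | suc _ = inj₂ (subst (λ x → κ k ≤ suc x) eq (compl-≤suc (mκ-qM k) (Grow⇒≤ up)) , s≤s z≤n)
  ... | zero = inj₁ (inj₁ (n≤0⇒n≡0 (subst (κ k ≤_) eq (compl-≤ (mκ-qM k) (grow⇒< up 0<q)))))
    where
    0<q : 0 < q k
    0<q = subst (0 <_) (sym (trans (sym (trans (cong (q k +_) eq) (+-identityʳ (q k)))) (qM k))) (s≤s z≤n)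

  squareBound : ∀ k → (∀ j → j < k → Up j) → (∀ j → j < k → Down j) → SquareBound (∑ q k) (∑ m k) (q k)
  squareBound zero up dn = mkSquare 0 refl z≤n (≤-trans (m≤m+n (q 0) (M 0)) (≤-reflexive (qM 0)))
  squareBound (suc k) up dn = SquareBound-step (up k ≤-refl) (compl-≤suc (qM-mκ k) (Grow⇒≤ (dn k ≤-refl)))
    (squareBound k (λ j lt → up j (m<n⇒m<1+n lt)) (λ j lt → dn j (m<n⇒m<1+n lt)))

  oblongBound : ∀ k → (∀ j → j ≤ k → Up j) → (∀ j → j < k → Down j) → OblongBound (∑ κ k) (∑ M (suc k)) (κ k)
  oblongBound zero up dn = mkOblong (M 0) refl (M≤M² (M 0) (≤-trans (m≤n+m (M 0) (q 0)) (≤-reflexive (qM 0)))) (bound (κ-bound 0 (up 0 z≤n)))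
    where
    M≤M² : ∀ x → x ≤ 1 → x ≤ x * x
    M≤M² .0 z≤n = z≤n
    M≤M² .1 (s≤s z≤n) = ≤-refl
    bound : Grow (κ 0) (M 0) ⊎ (κ 0 ≤ suc (M 0) × 0 < M 0) → κ 0 ≤ M 0 + M 0
    bound (inj₁ gr) = ≤-trans (Grow⇒≤ gr) (m≤m+n _ _)
    bound (inj₂ (le , lt)) = ≤-trans le (+-monoˡ-≤ (M 0) lt)
  oblongBound (suc k) up dn = OblongBound-step (dn k ≤-refl) (κ-bound (suc k) (up (suc k) ≤-refl))
    (oblongBound k (λ j le → up j (m≤n⇒m≤1+n le)) (λ j lt → dn j (m<n⇒m<1+n lt)))

  qSplit κSplit : ℕ → Set
  qSplit k = SplitBound 0 (∑ q k) (∑ m k) (q k)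
  κSplit k = SplitBound 1 (∑ κ k) (∑ M (suc k)) (κ k)

  κSplit-intro : ∀ k → (∀ j → j ≤ k → Up j) → (∀ j → j < k → Down j) → κ k ≡ 0 → κSplit k
  κSplit-intro k up dn κ≡0 = subst (SplitBound 1 (∑ κ k) (∑ M (suc k))) (sym κ≡0) (OblongBound⇒SplitBound (oblongBound k up dn))

  mutual
    -- The positivity carried by the second alternative makes the opposite growth strict, which is
    -- exactly what `SplitBound-step` requires to advance. Once it fails, the diagonal is extreme
    -- and the other kind of bound restarts there with γ = 0.
    state-κ : ∀ k → (∀ j → j ≤ k → Up j) → (∀ j → j < k → Down j) → κSplit k ⊎ (qSplit k × 0 < κ k)
    state-κ k up dn with κ k ≟ 0
    ... | yes κ≡0 = inj₁ (κSplit-intro k up dn κ≡0)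
    state-κ zero up dn | no κ≢0 with q 0 ≟ 0
    ... | yes q≡0 = inj₂ (mkSplit 0 0 refl z≤n (≤-reflexive q≡0) , n≢0⇒n>0 κ≢0)
    -- If the corner is in Q, then M 0 = 0, and strict growth forces κ 0 = 0.
    ... | no q≢0 = contradiction (n≤0⇒n≡0 (≤-trans (compl-≤ (mκ-qM 0) (grow⇒< (up 0 z≤n) (n≢0⇒n>0 q≢0))) M0≤0)) κ≢0
      where
      M0≤0 : M 0 ≤ 0
      M0≤0 = ≤-pred (≤-trans (+-monoˡ-≤ (M 0) (n≢0⇒n>0 q≢0)) (≤-reflexive (qM 0)))
    state-κ (suc k) up dn | no κ≢0 with state-q k (λ j le → up j (m≤n⇒m≤1+n le)) (λ j le → dn j (s≤s le))
    ... | inj₁ e = inj₂ (e , n≢0⇒n>0 κ≢0)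
    ... | inj₂ (f , 0<q) = inj₁ (SplitBound-step (dn k ≤-refl) (compl-≤ (mκ-qM (suc k)) (grow⇒< (up (suc k) ≤-refl) 0<q)) f)

    state-q : ∀ k → (∀ j → j ≤ k → Up j) → (∀ j → j ≤ k → Down j) → qSplit (suc k) ⊎ (κSplit k × 0 < q (suc k))
    state-q k up dn with q (suc k) ≟ 0
    ... | yes q≡0 = inj₁ (subst (SplitBound 0 (∑ q (suc k)) (∑ m (suc k))) (sym q≡0)
            (SquareBound⇒SplitBound (squareBound (suc k) (λ j lt → up j (≤-pred lt)) (λ j lt → dn j (≤-pred lt)))))
    ... | no q≢0 with state-κ k up (λ j lt → dn j (<⇒≤ lt))
    ... | inj₁ f = inj₂ (f , n≢0⇒n>0 q≢0)
    ... | inj₂ (e , 0<κ) = inj₁ (SplitBound-step (up k ≤-refl) (compl-≤ (qM-mκ k) (grow⇒< (dn k ≤-refl) 0<κ)) e)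

sum-qM : ∀ (c : Chain) n → ∑ (Chain.q c) n + ∑ (Chain.M c) n ≡ n * n
sum-qM c n = trans (sym (∑-+ (Chain.q c) (Chain.M c) n)) (trans (∑-cong n (λ k _ → Chain.qM c k)) (∑-odd n))

sum-mκ : ∀ (c : Chain) n → ∑ (Chain.m c) n + ∑ (Chain.κ c) n ≡ n * n + n
sum-mκ c n = trans (sym (∑-+ (Chain.m c) (Chain.κ c) n)) (trans (∑-cong n (λ k _ → Chain.mκ c k)) (∑-even n))

module _ (C C* : Chain) where
  open Chain C
  open Chain C* renaming (q to q*; m to m*; M to M*; κ to κ*; qM to qM*; mκ to mκ*)
  open ChainProperties C
  open ChainProperties C* using () renaming (Up to Up*; Down to Down*; state-κ to state-κ*; state-q to state-q*; κSplit to κSplit*; qSplit to qSplit*)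

  private
    -- Put c = c′ + 1. The diagonal totals turn the complement surplus into Σm* - Σq* = Gr - c, the
    -- middle diagonal adds m = 2c - k ≥ 2c - Gr, and the other half adds gl - a ≥ 0. `Gr` cancels
    -- and c remains.
    mixed-even : ∀ {Σq Σm a m k Σq* Σm* Σκ* ΣM* c′ gl Gr} →
      Σm ≡ Σq + gl → a ≤ gl → ΣM* ≡ Σκ* + Gr → k ≤ Gr →
      m + k ≡ suc (suc (c′ + c′)) → Σq* + ΣM* ≡ suc c′ * suc c′ → Σm* + Σκ* ≡ c′ * c′ + c′ →
      Σq + a + Σq* + suc c′ ≤ Σm + m + Σm*
    mixed-even {Σq} {Σm} {a} {m} {k} {Σq*} {Σm*} {Σκ*} {ΣM*} {c′} {gl} {Gr} refl a≤ refl k≤ e₁ e₂ e₃ =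
      +-cancelʳ-≤ (Σκ* + Gr) _ _ (begin
        Σq + a + Σq* + suc c′ + (Σκ* + Gr) ≡⟨ l₁ Σq a Σq* (suc c′) (Σκ* + Gr) ⟩
        Σq + a + (Σq* + (Σκ* + Gr)) + suc c′ ≡⟨ cong (λ z → Σq + a + z + suc c′) e₂ ⟩
        Σq + a + suc c′ * suc c′ + suc c′ ≡⟨ l₂ (Σq + a) c′ ⟩
        Σq + a + (suc (suc (c′ + c′)) + (c′ * c′ + c′)) ≡⟨ cong₂ (λ y z → Σq + a + (y + z)) (sym e₁) (sym e₃) ⟩
        Σq + a + (m + k + (Σm* + Σκ*)) ≤⟨ +-mono-≤ (+-monoʳ-≤ Σq a≤) (+-monoˡ-≤ (Σm* + Σκ*) (+-monoʳ-≤ m k≤)) ⟩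
        Σq + gl + (m + Gr + (Σm* + Σκ*)) ≡⟨ l₃ (Σq + gl) m Gr Σm* Σκ* ⟩
        Σq + gl + m + Σm* + (Σκ* + Gr) ∎)
      where
      open ≤-Reasoning
      l₁ : ∀ a b c d e → a + b + c + d + e ≡ a + b + (c + e) + d
      l₁ = solve-∀
      l₂ : ∀ a c → a + suc c * suc c + suc c ≡ a + (suc (suc (c + c)) + (c * c + c))
      l₂ = solve-∀
      l₃ : ∀ a m g s t → a + (m + g + (s + t)) ≡ a + m + s + (t + g)
      l₃ = solve-∀

    -- The totals now give Σm* - Σq* = c + Gr outright, and b ≤ gl pays for the shared diagonal b.
    mixed-odd : ∀ {Σq Σm b Σq* Σm* Σκ* ΣM* c gl Gr} →
      Σm ≡ Σq + gl → b ≤ gl → ΣM* ≡ Σκ* + Gr →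
      Σq* + ΣM* ≡ c * c → Σm* + Σκ* ≡ c * c + c →
      Σq + b + Σq* + c ≤ Σm + Σm*
    mixed-odd {Σq} {Σm} {b} {Σq*} {Σm*} {Σκ*} {ΣM*} {c} {gl} {Gr} refl b≤ refl e₂ e₃ =
      +-cancelʳ-≤ (Σκ* + Gr) _ _ (begin
        Σq + b + Σq* + c + (Σκ* + Gr) ≡⟨ l₁ Σq b Σq* c (Σκ* + Gr) ⟩
        Σq + b + (Σq* + (Σκ* + Gr)) + c ≡⟨ cong (λ z → Σq + b + z + c) e₂ ⟩
        Σq + b + c * c + c ≡⟨ +-assoc (Σq + b) (c * c) c ⟩
        Σq + b + (c * c + c) ≡⟨ cong (Σq + b +_) (sym e₃) ⟩
        Σq + b + (Σm* + Σκ*) ≤⟨ +-mono-≤ (+-monoʳ-≤ Σq b≤) (≤-by Gr (+-assoc Σm* Σκ* Gr)) ⟩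
        Σq + gl + (Σm* + (Σκ* + Gr)) ≡⟨ sym (+-assoc (Σq + gl) Σm* _) ⟩
        Σq + gl + Σm* + (Σκ* + Gr) ∎)
      where
      open ≤-Reasoning
      l₁ : ∀ a b c d e → a + b + c + d + e ≡ a + b + (c + e) + d
      l₁ = solve-∀

  -- Even side: the halves share an odd diagonal, the last one of m.
  profile-even : ∀ c′ → (∀ j → j ≤ c′ → Up j) → (∀ j → j < c′ → Down j) →
    (∀ j → j ≤ c′ → Up* j) → (∀ j → j < c′ → Down* j) → m c′ ≡ m* c′ →
    let p = ∑ q (suc c′) + ∑ q* (suc c′); d = ∑ m (suc c′) + ∑ m* c′; c = suc c′ in
    ∃ λ g → d ≡ p + g × (p ≤ g * g ⊎ c ≤ g ⊎ c * c + c * c ≤ p + (g * g + g))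
  profile-even c′ up dn up* dn* meq = cases (state-κ c′ up dn) (state-κ* c′ up* dn*)
    where
    c = suc c′
    p = ∑ q c + ∑ q* c
    d = ∑ m c + ∑ m* c′
    κeq : κ c′ ≡ κ* c′
    κeq = +-cancelˡ-≡ (m c′) _ _ (trans (mκ c′) (trans (sym (mκ* c′)) (cong (_+ κ* c′) (sym meq))))
    mid : m c′ + κ* c′ ≡ suc (suc (c′ + c′))
    mid = trans (cong (m c′ +_) (sym κeq)) (trans (mκ c′) (cong (λ z → suc (suc z)) (dbl≡ c′)))
    mid* : m* c′ + κ c′ ≡ suc (suc (c′ + c′))
    mid* = trans (cong₂ _+_ (sym meq) κeq) mid
    enough : p + c ≤ d → ∃ λ g → d ≡ p + g × (p ≤ g * g ⊎ c ≤ g ⊎ c * c + c * c ≤ p + (g * g + g))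
    enough le with ∃+ le
    ... | x , eq = c + x , trans eq (+-assoc p c x) , inj₂ (inj₁ (m≤m+n c x))
    cases : κSplit c′ ⊎ (qSplit c′ × 0 < κ c′) → κSplit* c′ ⊎ (qSplit* c′ × 0 < κ* c′) →
      ∃ λ g → d ≡ p + g × (p ≤ g * g ⊎ c ≤ g ⊎ c * c + c * c ≤ p + (g * g + g))
    cases (inj₂ (e , _)) (inj₂ (e* , _))
      with merge-split {m = m c′} z≤n (up c′ ≤-refl) (subst (Grow (q* c′)) (sym meq) (up* c′ ≤-refl)) e e*
    ... | g , eq , le = g , trans (sw (∑ m c′) (m c′) (∑ m* c′)) eq , inj₁ (≤-trans (m≤m+n _ _) le)
      where
      sw : ∀ a b c → a + b + c ≡ a + c + b
      sw = solve-∀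
    cases (inj₂ (mkSplit α γ O≡ _ a≤ , _)) (inj₁ (mkSplit α* γ* O≡* _ k≤)) = enough
      (mixed-even {Σq = ∑ q c′} {Σq* = ∑ q* c} {c′ = c′} O≡ (≤-trans a≤ (m≤n+m γ α)) O≡* (≤-trans k≤ (m≤n+m γ* α*)) mid (sum-qM C* c) (sum-mκ C* c′))
    cases (inj₁ (mkSplit α* γ* O≡* _ k≤)) (inj₂ (mkSplit α γ O≡ _ a≤ , _)) = enough
      (subst₂ _≤_ (cong (_+ c) (+-comm (∑ q* c) (∑ q c)))
        (trans (cong (λ z → ∑ m* c′ + z + ∑ m c′) (sym meq)) (sw (∑ m* c′) (m c′) (∑ m c′)))
        (mixed-even {Σq = ∑ q* c′} {Σq* = ∑ q c} {c′ = c′} O≡ (≤-trans a≤ (m≤n+m γ α)) O≡* (≤-trans k≤ (m≤n+m γ* α*)) mid* (sum-qM C c) (sum-mκ C c′)))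
      where
      sw : ∀ a b c → a + b + c ≡ c + b + a
      sw = solve-∀
    cases (inj₁ f) (inj₁ f*) with merge-shared {q = κ c′} f (subst (SplitBound 1 _ _) (sym κeq) f*)
    ... | g , eq , le = g , d≡ , inj₂ (inj₂ (≤-trans (≤-reflexive N≡) (+-monoʳ-≤ p (+-monoˡ-≤ g le))))
      where
      -- K counts the vertices outside N(Q) on the odd diagonals, so K + g is the number of vertices
      -- of V₁ outside Q.
      K = ∑ κ c′ + ∑ κ* c′ + κ c′
      sw : ∀ a b c d → a + b + (c + d) ≡ a + c + (b + d)
      sw = solve-∀
      N≡ : c * c + c * c ≡ p + (K + g)
      N≡ = trans (cong₂ _+_ (sym (sum-qM C c)) (sym (sum-qM C* c)))
             (trans (sw (∑ q c) (∑ M c) (∑ q* c) (∑ M* c)) (cong (p +_) eq))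
      dK : d + K ≡ c * c + c * c
      dK = trans (sw₂ (∑ m c′) (m c′) (∑ m* c′) (∑ κ c′) (∑ κ* c′) (κ c′))
        (trans (cong₂ _+_ (cong₂ _+_ (sum-mκ C c′) (sum-mκ C* c′)) (trans (mκ c′) (cong (λ z → suc (suc z)) (dbl≡ c′)))) (sw₃ c′))
        where
        sw₂ : ∀ a b c d e f → a + b + c + (d + e + f) ≡ a + d + (c + e) + (b + f)
        sw₂ = solve-∀
        sw₃ : ∀ c → c * c + c + (c * c + c) + suc (suc (c + c)) ≡ suc c * suc c + suc c * suc c
        sw₃ = solve-∀
      sw₄ : ∀ a b c → a + (b + c) ≡ a + c + b
      sw₄ = solve-∀
      d≡ : d ≡ p + g
      d≡ = +-cancelʳ-≡ K d (p + g) (trans dK (trans N≡ (sw₄ p K g)))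

  -- Odd side: the halves share an even diagonal.  The second alternative counts g + 1, since
  -- g itself may be -1.
  profile-odd : ∀ c → (∀ j → j < c → Up j) → (∀ j → j < c → Down j) →
    (∀ j → j < c → Up* j) → (∀ j → j < c → Down* j) → q c ≡ q* c →
    let p = ∑ q (suc c) + ∑ q* c; d = ∑ m c + ∑ m* c in
    (∃ λ g → d ≡ p + g × (p ≤ g * g ⊎ c ≤ g)) ⊎
    (∃ λ g → suc d ≡ p + g × suc c * suc c + c * c ≤ p + g * g)
  profile-odd zero up dn up* dn* _ with q 0 | M 0 | qM 0
  ... | zero | _ | _ = inj₁ (0 , refl , inj₁ z≤n)
  -- The 1 × 1 grid with its vertex in Q: p = 1 and d = 0, so the surplus is -1.
  ... | suc zero | _ | _ = inj₂ (0 , refl , ≤-refl)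
  ... | suc (suc _) | _ | ()
  profile-odd (suc c′) up dn up* dn* qeq = cases
      (state-q c′ (λ j le → up j (s≤s le)) (λ j le → dn j (s≤s le)))
      (state-q* c′ (λ j le → up* j (s≤s le)) (λ j le → dn* j (s≤s le)))
    where
    c = suc c′
    p = ∑ q (suc c) + ∑ q* c
    d = ∑ m c + ∑ m* c
    Goal = (∃ λ g → d ≡ p + g × (p ≤ g * g ⊎ c ≤ g)) ⊎ (∃ λ g → suc d ≡ p + g × suc c * suc c + c * c ≤ p + g * g)
    Meq : M c ≡ M* c
    Meq = +-cancelˡ-≡ (q c) _ _ (trans (qM c) (trans (sym (qM* c)) (cong (_+ M* c) (sym qeq))))
    enough : p + c ≤ d → Goal
    enough le with ∃+ le
    ... | x , eq = inj₁ (c + x , trans eq (+-assoc p c x) , inj₂ (m≤m+n c x))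
    sw : ∀ a b c → a + b + c ≡ a + c + b
    sw = solve-∀
    κ≤M : ∀ {ΣM Σκ k α γ} → ΣM ≡ Σκ + (α + γ) → k ≤ γ → ∃ λ G → ΣM ≡ Σκ + k + G
    κ≤M {Σκ = Σκ} {k} {α} refl k≤ = ∃+ (+-monoʳ-≤ Σκ (≤-trans k≤ (m≤n+m _ α)))
    cases : qSplit c ⊎ (κSplit c′ × 0 < q c) → qSplit* c ⊎ (κSplit* c′ × 0 < q* c) → Goal
    cases (inj₁ e) (inj₁ e*) with merge-shared {q = q c} e (subst (SplitBound 0 _ _) (sym qeq) e*)
    ... | g , eq , le = inj₁ (g , trans eq (cong (_+ g) (sw (∑ q c) (∑ q* c) (q c))) ,
                              inj₁ (subst (_≤ g * g) (sw (∑ q c) (∑ q* c) (q c)) le))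
    cases (inj₁ (mkSplit α γ O≡ _ b≤)) (inj₂ (mkSplit α* γ* O≡* _ k≤ , _)) = enough
      (mixed-odd {Σq = ∑ q c} {Σq* = ∑ q* c} O≡ (≤-trans b≤ (m≤n+m γ α)) (proj₂ (κ≤M {Σκ = ∑ κ* c′} {α = α*} O≡* k≤)) (sum-qM C* c) (sum-mκ C* c))
    cases (inj₂ (mkSplit α* γ* O≡* _ k≤ , _)) (inj₁ (mkSplit α γ O≡ _ b≤)) = enough
      (subst₂ _≤_ (cong (_+ c) (trans (cong (λ z → ∑ q* c + z + ∑ q c) (sym qeq)) (sw′ (∑ q* c) (q c) (∑ q c))))
        (+-comm (∑ m* c) (∑ m c))
        (mixed-odd {Σq = ∑ q* c} {Σq* = ∑ q c} O≡ (≤-trans b≤ (m≤n+m γ α)) (proj₂ (κ≤M {Σκ = ∑ κ c′} {α = α*} O≡* k≤)) (sum-qM C c) (sum-mκ C c)))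
      where
      sw′ : ∀ a b c → a + b + c ≡ c + b + a
      sw′ = solve-∀
    -- The complement of Q in V₁ has K + g vertices, and e = 1 bounds this whole sum by g², not only
    -- K.
    cases (inj₂ (f , _)) (inj₂ (f* , _))
      with merge-split {m = M c} ≤-refl (dn c′ ≤-refl) (subst (Grow (κ* c′)) (sym Meq) (dn* c′ ≤-refl)) f f*
    ... | g , eq , le = inj₂ (g , d≡ , ≤-trans (≤-reflexive N≡) (+-monoʳ-≤ p (subst (λ z → K + z ≤ g * g) (*-identityˡ g) le)))
      where
      K = ∑ κ c + ∑ κ* c
      sw₁ : ∀ c → suc c * suc c + c * c ≡ c * c + suc (c + c) + c * c
      sw₁ = solve-∀
      sw₂ : ∀ a b c d e f → a + b + (c + d) + (e + f) ≡ a + c + e + (b + f + d)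
      sw₂ = solve-∀
      N≡ : suc c * suc c + c * c ≡ p + (K + g)
      N≡ = trans (sw₁ c) (trans (cong₂ (λ x y → x + suc y + c * c) (sym (sum-qM C c)) (sym (dbl≡ c)))
             (trans (cong₂ (λ x y → ∑ q c + ∑ M c + x + y) (sym (qM c)) (sym (sum-qM C* c)))
             (trans (sw₂ (∑ q c) (∑ M c) (q c) (M c) (∑ q* c) (∑ M* c))
               (cong (p +_) eq))))
      sw₃ : ∀ a b c d → a + b + (c + d) ≡ a + c + (b + d)
      sw₃ = solve-∀
      sw₅ : ∀ c → suc (c * c + c + (c * c + c)) ≡ suc c * suc c + c * c
      sw₅ = solve-∀
      dK : suc d + K ≡ suc c * suc c + c * c
      dK = trans (cong suc (trans (sw₃ (∑ m c) (∑ m* c) (∑ κ c) (∑ κ* c)) (cong₂ _+_ (sum-mκ C c) (sum-mκ C* c)))) (sw₅ c)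
      sw₄ : ∀ a b c → a + (b + c) ≡ a + c + b
      sw₄ = solve-∀
      d≡ : suc d ≡ p + g
      d≡ = +-cancelʳ-≡ K (suc d) (p + g) (trans dK (trans N≡ (sw₄ p K g)))

-- Antidiagonal counts

𝟙 : Bool → ℕ
𝟙 false = 0
𝟙 true = 1

𝟙≤1 : ∀ b → 𝟙 b ≤ 1
𝟙≤1 false = z≤n
𝟙≤1 true = ≤-refl

-- D f s counts the points of f on the antidiagonal i + j ≡ s.
D : (ℕ → ℕ → Bool) → ℕ → ℕ
D f zero = 𝟙 (f 0 0)
D f (suc s) = 𝟙 (f (suc s) 0) + D (λ i j → f i (suc j)) s

up-s : ∀ {i j s} → i + j ≡ s → i + suc j ≡ suc s
up-s {i} {j} refl = +-suc i j

D-compl : ∀ f s → D f s + D (λ i j → not (f i j)) s ≡ suc s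
D-compl f zero with f 0 0
... | false = refl
... | true = refl
D-compl f (suc s) with f (suc s) 0
... | true = cong suc (D-compl (λ i j → f i (suc j)) s)
... | false = trans (+-suc _ _) (cong suc (D-compl (λ i j → f i (suc j)) s))

D-cong : ∀ {f g} s → (∀ i j → i + j ≡ s → f i j ≡ g i j) → D f s ≡ D g s
D-cong zero h = cong 𝟙 (h 0 0 refl)
D-cong (suc s) h = cong₂ _+_ (cong 𝟙 (h (suc s) 0 (+-identityʳ _))) (D-cong s (λ i j e → h i (suc j) (up-s e)))

-- Each point steps right to a distinct point of the next diagonal, and the point with the largest j
-- also steps up to a new one. The recursion on columns meets that last point when the rest of the
-- diagonal is empty.
D-grow : ∀ {f g} s →
  (∀ i j → i + j ≡ s → f i j ≡ true → g (suc i) j ≡ true × g i (suc j) ≡ true) →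
  Grow (D f s) (D g (suc s))
D-grow {f} {g} zero h with f 0 0 in eq
... | false = inj₁ refl
... | true rewrite proj₁ (h 0 0 refl eq) | proj₂ (h 0 0 refl eq) = inj₂ ≤-refl
D-grow {f} {g} (suc s) h with f (suc s) 0 in eq | D-grow {λ i j → f i (suc j)} {λ i j → g i (suc j)} s (λ i j e → h i (suc j) (up-s e))
... | false | inj₁ z = inj₁ z
... | false | inj₂ lt = inj₂ (≤-trans lt (m≤n+m _ (𝟙 (g (suc (suc s)) 0))))
... | true | ih with h (suc s) 0 (+-identityʳ _) eq
... | g₁ , g₂ rewrite g₁ with ih
...   | inj₂ lt = inj₂ (s≤s lt)
...   | inj₁ z rewrite z | g₂ = inj₂ (s≤s (s≤s z≤n))

D-back : ∀ f s → D f (suc s) ≡ D (λ i j → f (suc i) j) s + 𝟙 (f 0 (suc s))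
D-back f zero = refl
D-back f (suc s) = trans (cong (𝟙 (f (suc (suc s)) 0) +_) (D-back (λ i j → f i (suc j)) s))
  (sym (+-assoc (𝟙 (f (suc (suc s)) 0)) _ _))

D-flip : ∀ f s → D f s ≡ D (flip f) s
D-flip f zero = refl
D-flip f (suc s) = trans (cong (𝟙 (f (suc s) 0) +_) (D-flip (λ i j → f i (suc j)) s))
  (trans (+-comm (𝟙 (f (suc s) 0)) _) (sym (D-back (flip f) s)))

D-none : ∀ f s → (∀ i j → i + j ≡ s → f i j ≡ false) → D f s ≡ 0
D-none f zero h = cong 𝟙 (h 0 0 refl)
D-none f (suc s) h rewrite h (suc s) 0 (+-identityʳ _) = D-none _ s (λ i j e → h i (suc j) (up-s e))

D-all : ∀ f s → (∀ i j → i + j ≡ s → f i j ≡ true) → D f s ≡ suc s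
D-all f zero h = cong 𝟙 (h 0 0 refl)
D-all f (suc s) h rewrite h (suc s) 0 (+-identityʳ _) = cong suc (D-all _ s (λ i j e → h i (suc j) (up-s e)))

D≤ : ∀ f s → D f s ≤ suc s
D≤ f zero = 𝟙≤1 _
D≤ f (suc s) = +-mono-≤ (𝟙≤1 (f (suc s) 0)) (D≤ _ s)

D≤-col : ∀ f s r → (∀ i j → i + j ≡ s → f i j ≡ true → j < r) → D f s ≤ r
D≤-col f s zero h = ≤-reflexive (D-none f s (λ i j e → ¬-not (λ t → n≮0 (h i j e t))))
D≤-col f zero (suc r) h = ≤-trans (𝟙≤1 _) (s≤s z≤n)
D≤-col f (suc s) (suc r) h = +-mono-≤ (𝟙≤1 (f (suc s) 0))
  (D≤-col _ s r (λ i j e t → ≤-pred (h i (suc j) (up-s e) t)))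

D≤-row : ∀ f s r → (∀ i j → i + j ≡ s → f i j ≡ true → i < r) → D f s ≤ r
D≤-row f s r h = ≤-trans (≤-reflexive (D-flip f s))
  (D≤-col (flip f) s r (λ i j e → h j i (trans (+-comm j i) e)))

∑-front : ∀ g n → ∑ g (suc n) ≡ g 0 + ∑ (g ∘ suc) n
∑-front g zero = +-comm 0 (g 0)
∑-front g (suc n) = trans (cong (_+ g (suc n)) (∑-front g n)) (+-assoc (g 0) _ _)

∑-rev : ∀ h a b → ∑ h (a + b) ≡ ∑ h a + ∑ (λ i → h (a + b ∸ suc i)) b
∑-rev h a zero = trans (cong (∑ h) (+-identityʳ a)) (sym (+-identityʳ _))
∑-rev h a (suc b) rewrite +-suc a b = begin
  ∑ h (a + b) + h (a + b) ≡⟨ cong (_+ h (a + b)) (∑-rev h a b) ⟩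
  ∑ h a + ∑ (λ i → h (a + b ∸ suc i)) b + h (a + b) ≡⟨ +-assoc (∑ h a) _ _ ⟩
  ∑ h a + (∑ (λ i → h (a + b ∸ suc i)) b + h (a + b)) ≡⟨ cong (∑ h a +_) (+-comm _ (h (a + b))) ⟩
  ∑ h a + (h (a + b) + ∑ (λ i → h (a + b ∸ suc i)) b) ≡⟨ cong (∑ h a +_) (sym (∑-front (λ i → h (a + b ∸ i)) b)) ⟩
  ∑ h a + ∑ (λ i → h (a + b ∸ i)) (suc b) ∎
  where open ≡-Reasoning

Tri Sq : (ℕ → ℕ → Bool) → ℕ → ℕ
Tri f M = ∑ (λ j → ∑ (λ i → 𝟙 (f i j)) (M ∸ j)) M
Sq f n = ∑ (λ j → ∑ (λ i → 𝟙 (f i j)) n) n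

∑-D : ∀ f M → ∑ (D f) M ≡ Tri f M
∑-D f zero = refl
∑-D f (suc M) = begin
  ∑ (D f) (suc M) ≡⟨ ∑-front (D f) M ⟩
  𝟙 (f 0 0) + ∑ (λ s → 𝟙 (f (suc s) 0) + D f′ s) M
    ≡⟨ cong (𝟙 (f 0 0) +_) (∑-+ (λ s → 𝟙 (f (suc s) 0)) (D f′) M) ⟩
  𝟙 (f 0 0) + (∑ (λ s → 𝟙 (f (suc s) 0)) M + ∑ (D f′) M) ≡⟨ sym (+-assoc (𝟙 (f 0 0)) _ _) ⟩
  𝟙 (f 0 0) + ∑ (λ s → 𝟙 (f (suc s) 0)) M + ∑ (D f′) M
    ≡⟨ cong₂ _+_ (sym (∑-front (λ i → 𝟙 (f i 0)) M)) (∑-D f′ M) ⟩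
  ∑ (λ i → 𝟙 (f i 0)) (suc M) + Tri f′ M ≡⟨ sym (∑-front (λ j → ∑ (λ i → 𝟙 (f i j)) (suc M ∸ j)) M) ⟩
  Tri f (suc M) ∎
  where
  open ≡-Reasoning
  f′ : ℕ → ℕ → Bool
  f′ i j = f i (suc j)

reflect : ℕ → (ℕ → ℕ → Bool) → ℕ → ℕ → Bool
reflect n′ f i j = f (n′ ∸ i) (n′ ∸ j)

-- The antidiagonals beyond the main one are counted after a point reflection of the square.
Sq-diagonals : ∀ f n′ → Sq f (suc n′) ≡ ∑ (D f) (suc n′) + ∑ (D (reflect n′ f)) n′
Sq-diagonals f n′ = begin
  ∑ (λ j → ∑ (λ i → 𝟙 (f i j)) n) n ≡⟨ ∑-cong n split ⟩
  ∑ (λ j → ∑ (λ i → 𝟙 (f i j)) (n ∸ j) + G j) n ≡⟨ ∑-+ _ G n ⟩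
  Tri f n + ∑ G n ≡⟨ cong (Tri f n +_) (∑-rev G 0 n) ⟩
  Tri f n + (∑ (λ j → G (n′ ∸ j)) n′ + G (n′ ∸ n′)) ≡⟨ cong (λ z → Tri f n + (∑ (λ j → G (n′ ∸ j)) n′ + G z)) (n∸n≡0 n′) ⟩
  -- `G (n′ ∸ j)` unfolds to row j of the reflected triangle, and `G 0` is an empty sum.
  Tri f n + (Tri (reflect n′ f) n′ + 0) ≡⟨ cong₂ _+_ (sym (∑-D f n)) (trans (+-identityʳ _) (sym (∑-D (reflect n′ f) n′))) ⟩
  ∑ (D f) n + ∑ (D (reflect n′ f)) n′ ∎
  where
  open ≡-Reasoning
  n = suc n′
  G : ℕ → ℕ
  G j = ∑ (λ i → 𝟙 (f (n′ ∸ i) j)) j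
  split : ∀ j → j < n → ∑ (λ i → 𝟙 (f i j)) n ≡ ∑ (λ i → 𝟙 (f i j)) (n ∸ j) + G j
  split j j<n = trans (cong (∑ h) (sym eq)) (trans (∑-rev h (n ∸ j) j)
      (cong (∑ h (n ∸ j) +_) (∑-cong j (λ i _ → cong (λ z → h (z ∸ suc i)) eq))))
    where
    h : ℕ → ℕ
    h i = 𝟙 (f i j)
    eq : n ∸ j + j ≡ n
    eq = m∸n+n≡m (<⇒≤ j<n)

-- Totalises the indexing: only the values at i ≤ n′ matter.
clamp : ∀ {n′} → ℕ → Fin (suc n′)
clamp {n′} i = fromℕ< (s≤s (m⊓n≤n i n′))

toℕ-clamp : ∀ {n′ i} → i ≤ n′ → toℕ (clamp {n′} i) ≡ i
toℕ-clamp {n′} {i} i≤n′ = trans (toℕ-fromℕ< (s≤s (m⊓n≤n i n′))) (m≤n⇒m⊓n≡m i≤n′)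

clamp-toℕ : ∀ {n′} (i : Fin (suc n′)) → clamp (toℕ i) ≡ i
clamp-toℕ i = toℕ-injective (toℕ-clamp (toℕ≤pred[n] i))

ext : ∀ {n′} → Subset (suc n′) → ℕ → ℕ → Bool
ext S i j = S (clamp i , clamp j)

-- Cardinalities as double sums over the square

length-concatMap-tabulate : ∀ {A B : Set} (f : A → List B) {n} (h : Fin n → A) (k : ℕ → ℕ) →
  (∀ i → length (f (h i)) ≡ k (toℕ i)) → length (concatMap f (tabulate h)) ≡ ∑ k n
length-concatMap-tabulate f {zero} h k e = refl
length-concatMap-tabulate f {suc n} h k e = begin
  length (f (h Fin.zero) ++ concatMap f (tabulate (h ∘ Fin.suc))) ≡⟨ length-++ (f (h Fin.zero)) ⟩
  length (f (h Fin.zero)) + length (concatMap f (tabulate (h ∘ Fin.suc)))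
    ≡⟨ cong₂ _+_ (e Fin.zero) (length-concatMap-tabulate f (h ∘ Fin.suc) (k ∘ suc) (e ∘ Fin.suc)) ⟩
  k 0 + ∑ (k ∘ suc) n ≡⟨ sym (∑-front k n) ⟩
  ∑ k (suc n) ∎
  where open ≡-Reasoning

filterᵇ-concatMap : ∀ {A B : Set} (P : B → Bool) (f : A → List B) xs →
  filterᵇ P (concatMap f xs) ≡ concatMap (filterᵇ P ∘ f) xs
filterᵇ-concatMap P f [] = refl
filterᵇ-concatMap P f (x ∷ xs) = trans (filter-++ (T? ∘ P) (f x) (concatMap f xs))
  (cong (filterᵇ P (f x) ++_) (filterᵇ-concatMap P f xs))

length-filterᵇ-map-tabulate : ∀ {A B : Set} (P : B → Bool) (g : A → B) {n} (h : Fin n → A) (k : ℕ → Bool) →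
  (∀ i → P (g (h i)) ≡ k (toℕ i)) → length (filterᵇ P (map g (tabulate h))) ≡ ∑ (𝟙 ∘ k) n
length-filterᵇ-map-tabulate P g {zero} h k e = refl
length-filterᵇ-map-tabulate P g {suc n} h k e
  rewrite ∑-front (𝟙 ∘ k) n | sym (e Fin.zero) with P (g (h Fin.zero))
... | true = cong suc (length-filterᵇ-map-tabulate P g (h ∘ Fin.suc) (k ∘ suc) (e ∘ Fin.suc))
... | false = length-filterᵇ-map-tabulate P g (h ∘ Fin.suc) (k ∘ suc) (e ∘ Fin.suc)

row : ∀ {n} → Fin n → List (Vertex n)
row {n} j = map (λ i → (i , j)) (allFin n)

card-Sq : ∀ {n′} (S : Subset (suc n′)) (f : ℕ → ℕ → Bool) →
  (∀ i j → S (i , j) ≡ f (toℕ i) (toℕ j)) → card S ≡ Sq f (suc n′)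
card-Sq {n′} S f e = trans (cong length (filterᵇ-concatMap S row (allFin (suc n′))))
  (length-concatMap-tabulate (filterᵇ S ∘ row) id _ (λ j →
    length-filterᵇ-map-tabulate S (λ i → (i , j)) id (λ i → f i (toℕ j)) (λ i → e i j)))

card-ext : ∀ {n′} (S : Subset (suc n′)) → card S ≡ Sq (ext S) (suc n′)
card-ext S = card-Sq S (ext S) (λ i j → cong S (cong₂ _,_ (sym (clamp-toℕ i)) (sym (clamp-toℕ j))))

-- From the grid to its diagonals

data Adj : ℕ → ℕ → ℕ → ℕ → Set where
  right : ∀ {i j} → Adj i j (suc i) j
  left  : ∀ {i j} → Adj (suc i) j i j
  up    : ∀ {i j} → Adj i j i (suc j)
  down  : ∀ {i j} → Adj i (suc j) i j

∣n-1+n∣ : ∀ n → ∣ n - suc n ∣ ≡ 1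
∣n-1+n∣ zero = refl
∣n-1+n∣ (suc n) = ∣n-1+n∣ n

∣1+n-n∣ : ∀ n → ∣ suc n - n ∣ ≡ 1
∣1+n-n∣ n = trans (∣-∣-comm (suc n) n) (∣n-1+n∣ n)

∣-∣≡1 : ∀ a b → ∣ a - b ∣ ≡ 1 → b ≡ suc a ⊎ a ≡ suc b
∣-∣≡1 zero .1 refl = inj₁ refl
∣-∣≡1 (suc zero) zero e = inj₂ refl
∣-∣≡1 (suc a) (suc b) e with ∣-∣≡1 a b e
... | inj₁ x = inj₁ (cong suc x)
... | inj₂ x = inj₂ (cong suc x)

Adj⇒dist : ∀ {i j i′ j′} → Adj i j i′ j′ → ∣ i - i′ ∣ + ∣ j - j′ ∣ ≡ 1
Adj⇒dist (right {i} {j}) = cong₂ _+_ (∣n-1+n∣ i) (∣n-n∣≡0 j)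
Adj⇒dist (left {i} {j}) = cong₂ _+_ (∣1+n-n∣ i) (∣n-n∣≡0 j)
Adj⇒dist (up {i} {j}) = cong₂ _+_ (∣n-n∣≡0 i) (∣n-1+n∣ j)
Adj⇒dist (down {i} {j}) = cong₂ _+_ (∣n-n∣≡0 i) (∣1+n-n∣ j)

dist⇒Adj : ∀ {i j i′ j′} → ∣ i - i′ ∣ + ∣ j - j′ ∣ ≡ 1 → Adj i j i′ j′
dist⇒Adj {i} {j} {i′} {j′} e with ∣ i - i′ ∣ in ei | ∣ j - j′ ∣ in ej
dist⇒Adj {i} {j} {i′} {j′} refl | zero | suc zero with ∣m-n∣≡0⇒m≡n {i} ei | ∣-∣≡1 j j′ ej
... | refl | inj₁ refl = up
... | refl | inj₂ refl = down
dist⇒Adj {i} {j} {i′} {j′} refl | suc zero | zero with ∣m-n∣≡0⇒m≡n {j} ej | ∣-∣≡1 i i′ ei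
... | refl | inj₁ refl = right
... | refl | inj₂ refl = left

∸-flip : ∀ {n′ i} → suc i ≤ n′ → n′ ∸ i ≡ suc (n′ ∸ suc i)
∸-flip le = +-∸-assoc 1 le

Adj-flip : ∀ {n′ i j i′ j′} → i ≤ n′ → i′ ≤ n′ → Adj i j i′ j′ → Adj (n′ ∸ i) j (n′ ∸ i′) j′
Adj-flip _ le (right) rewrite ∸-flip le = left
Adj-flip le _ (left) rewrite ∸-flip le = right
Adj-flip _ _ up = up
Adj-flip _ _ down = down

Adj-swap : ∀ {i j i′ j′} → Adj i j i′ j′ → Adj j i j′ i′
Adj-swap right = up
Adj-swap left = down
Adj-swap up = right
Adj-swap down = left

∈-vertices : ∀ {n} (v : Vertex n) → v ∈ vertices n
∈-vertices {n} (i , j) = ∈-concatMap⁺ row (lose (∈-allFin j) (∈-map⁺ (λ i → i , j) (∈-allFin i)))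

⇒T : ∀ {b} → b ≡ true → T b
⇒T = Equivalence.from T-≡

T⇒ : ∀ {b} → T b → b ≡ true
T⇒ = Equivalence.to T-≡

AdjV : ∀ {n} → Vertex n → Vertex n → Set
AdjV (i , j) (i′ , j′) = Adj (toℕ i) (toℕ j) (toℕ i′) (toℕ j′)

inN⁺ : ∀ {n} (S : Subset n) u v → S u ≡ true → S v ≡ false → AdjV u v → inN S v ≡ true
inN⁺ {n} S u v Su Sv a rewrite Sv = T⇒ (any⁺ (λ u → S u ∧ adj u v)
  (lose (∈-vertices u) (Equivalence.from T-∧ (⇒T Su , ≡⇒≡ᵇ _ 1 (Adj⇒dist a)))))

inN⁻ : ∀ {n} (S : Subset n) v → inN S v ≡ true → ∃ λ u → S u ≡ true × AdjV u v
inN⁻ {n} S v e with find (any⁻ (λ u → S u ∧ adj u v) (vertices n) (proj₂ (Equivalence.to (T-∧ {not (S v)}) (⇒T e))))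
... | u , _ , t with Equivalence.to (T-∧ {S u}) t
... | Su , d = u , T⇒ Su , dist⇒Adj (≡ᵇ⇒≡ _ 1 d)

ev : ℕ → Bool
ev zero = true
ev (suc n) = not (ev n)

ev-dbl : ∀ k → ev (dbl k) ≡ true
ev-dbl zero = refl
ev-dbl (suc k) = trans (not-involutive _) (ev-dbl k)

%2-ev : ∀ n → (n % 2 ≡ᵇ 0) ≡ ev n
%2-ev zero = refl
%2-ev (suc zero) = refl
%2-ev (suc (suc n)) = trans (%2-ev n) (sym (not-involutive _))

inV1-ev : ∀ {n} (i j : Fin n) → inV1 (i , j) ≡ ev (toℕ i + toℕ j)
inV1-ev i j = trans (%2-ev (suc (toℕ i) + suc (toℕ j)))
  (trans (cong (not ∘ ev) (+-suc (toℕ i) (toℕ j))) (not-involutive _))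

ev-+ : ∀ a b → ev (a + b) ≡ true → ev a ≡ ev b
ev-+ zero b e = sym e
ev-+ (suc a) b e = trans (cong not (ev-+ a (suc b) (trans (cong ev (+-suc a b)) e))) (not-involutive _)

ev-+ᶠ : ∀ a b → ev a ≡ ev b → ev (a + b) ≡ true
ev-+ᶠ zero b e = sym e
ev-+ᶠ (suc a) b e = trans (cong ev (sym (+-suc a b)))
  (ev-+ᶠ a (suc b) (trans (sym (not-involutive _)) (cong not e)))

Adj-ev : ∀ {i j i′ j′} → Adj i j i′ j′ → ev (i′ + j′) ≡ not (ev (i + j))
Adj-ev right = refl
Adj-ev left = sym (not-involutive _)
Adj-ev (up {i} {j}) = cong ev (+-suc i j)
Adj-ev (down {i} {j}) = sym (trans (cong (not ∘ ev) (+-suc i j)) (not-involutive _))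

reflect-ev : ∀ {n′ i j} → i ≤ n′ → j ≤ n′ → ev ((n′ ∸ i) + (n′ ∸ j)) ≡ ev (i + j)
reflect-ev {n′} {i} {j} i≤ j≤ = ev-+ ((n′ ∸ i) + (n′ ∸ j)) (i + j)
  (trans (cong ev (trans (lem (n′ ∸ i) (n′ ∸ j) i j) (cong₂ _+_ (m∸n+n≡m i≤) (m∸n+n≡m j≤)))) (ev-+ᶠ n′ n′ refl))
  where
  lem : ∀ a b c d → a + b + (c + d) ≡ a + c + (b + d)
  lem = solve-∀

GridAdj : ℕ → (A B : ℕ → ℕ → Bool) → Set
GridAdj n′ A B = ∀ {i j i′ j′} → Adj i j i′ j′ → i ≤ n′ → j ≤ n′ → i′ ≤ n′ → j′ ≤ n′ →
  A i j ≡ true → B i′ j′ ≡ true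

Even : ℕ → (ℕ → ℕ → Bool) → Set
Even n′ A = ∀ {i j} → i ≤ n′ → j ≤ n′ → A i j ≡ true → ev (i + j) ≡ true

GridAdj-reflect : ∀ {n′ A B} → GridAdj n′ A B → GridAdj n′ (reflect n′ A) (reflect n′ B)
GridAdj-reflect {n′} g {i} {j} {i′} {j′} a i≤ j≤ i′≤ j′≤ =
  g (Adj-swap (Adj-flip j≤ j′≤ (Adj-swap (Adj-flip i≤ i′≤ a))))
    (m∸n≤m n′ i) (m∸n≤m n′ j) (m∸n≤m n′ i′) (m∸n≤m n′ j′)

Even-reflect : ∀ {n′ A} → Even n′ A → Even n′ (reflect n′ A)
Even-reflect {n′} h {i} {j} i≤ j≤ t = trans (sym (reflect-ev i≤ j≤)) (h (m∸n≤m n′ i) (m∸n≤m n′ j) t)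

true≢false : ∀ {b} {X : Set} → b ≡ true → b ≡ false → X
true≢false refl ()

contrapose : ∀ {a b} → (a ≡ true → b ≡ true) → not b ≡ true → not a ≡ true
contrapose {false} h _ = refl
contrapose {true} h e = trans (cong not (sym (h refl))) e

i≤i+j : ∀ {i j s n′} → i + j ≡ s → s ≤ n′ → i ≤ n′ × j ≤ n′
i≤i+j {i} {j} refl le = ≤-trans (m≤m+n i j) le , ≤-trans (m≤n+m j i) le

chain : (A B : ℕ → ℕ → Bool) → Chain
chain A B = record
  { q = λ k → D A (dbl k)
  ; m = λ k → D B (suc (dbl k))
  ; M = λ k → D (λ i j → not (A i j)) (dbl k)
  ; κ = λ k → D (λ i j → not (B i j)) (suc (dbl k))
  ; qM = λ k → D-compl A (dbl k)
  ; mκ = λ k → D-compl B (suc (dbl k))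
  }

module _ {n′ A B} (g : GridAdj n′ A B) where
  private
    s≤ : ∀ {i j s} → i + j ≡ s → suc s ≤ n′ → (i ≤ n′ × j ≤ n′) × (suc i ≤ n′ × suc j ≤ n′)
    s≤ {i} {j} e le = i≤i+j e (<⇒≤ le) ,
      proj₁ (i≤i+j {suc i} {j} (cong suc e) le) , proj₂ (i≤i+j {i} {suc j} (up-s e) le)

  grow-up : ∀ s → suc s ≤ n′ → Grow (D A s) (D B (suc s))
  grow-up s le = D-grow {A} {B} s (λ i j e t → let (i≤ , j≤) , (si≤ , sj≤) = s≤ e le in
    g right i≤ j≤ si≤ j≤ t , g up i≤ j≤ i≤ sj≤ t)

  -- Adjacency read backwards: a point outside B has no neighbour in A, so the complement of B
  -- spreads into the complement of A.
  grow-down : ∀ s → suc s ≤ n′ → Grow (D (λ i j → not (B i j)) s) (D (λ i j → not (A i j)) (suc s))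
  grow-down s le = D-grow {λ i j → not (B i j)} {λ i j → not (A i j)} s (λ i j e t → let (i≤ , j≤) , (si≤ , sj≤) = s≤ e le in
    contrapose (g left si≤ j≤ i≤ j≤) t , contrapose (g down i≤ sj≤ i≤ j≤) t)

D-even : ∀ {n′ A} → Even n′ A → ∀ s → s ≤ n′ → ev s ≡ false → D A s ≡ 0
D-even {n′} {A} h s s≤n′ os = D-none A s none
  where
  none : ∀ i j → i + j ≡ s → A i j ≡ false
  none i j refl with A i j in t
  ... | false = refl
  ... | true = let (i≤ , j≤) = i≤i+j refl s≤n′ in true≢false (h i≤ j≤ t) os

-- The point reflection maps the middle antidiagonal to itself. This makes the two chains agree on
-- it, as the gluing demands.
D-reflect : ∀ f n′ → D f n′ ≡ D (reflect n′ f) n′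
D-reflect f n′ = trans (D-flip f n′) (D-cong n′ h)
  where
  h : ∀ i j → i + j ≡ n′ → f j i ≡ f (n′ ∸ i) (n′ ∸ j)
  h i j refl = cong₂ f (sym (m+n∸m≡n i j)) (sym (m+n∸n≡m i j))

∑-dbl : ∀ f k → ∑ f (dbl k) ≡ ∑ (λ k → f (dbl k) + f (suc (dbl k))) k
∑-dbl f zero = refl
∑-dbl f (suc k) = trans (+-assoc (∑ f (dbl k)) (f (dbl k)) _) (cong (_+ (f (dbl k) + f (suc (dbl k)))) (∑-dbl f k))

dbl-mono : ∀ {j k} → j ≤ k → dbl j ≤ dbl k
dbl-mono z≤n = z≤n
dbl-mono (s≤s le) = s≤s (s≤s (dbl-mono le))

ev-suc-dbl : ∀ k → ev (suc (dbl k)) ≡ false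
ev-suc-dbl k = cong not (ev-dbl k)

∑-evens : ∀ f c → (∀ s → s < dbl c → ev s ≡ false → f s ≡ 0) → ∑ f (dbl c) ≡ ∑ (f ∘ dbl) c
∑-evens f c h = trans (∑-dbl f c) (∑-cong c (λ k k<c →
  trans (cong (f (dbl k) +_) (h (suc (dbl k)) (dbl-mono k<c) (ev-suc-dbl k))) (+-identityʳ _)))

∑-odds≤ : ∀ f c → ∑ (f ∘ suc ∘ dbl) c ≤ ∑ f (dbl c)
∑-odds≤ f c = ≤-trans (m≤n+m _ (∑ (f ∘ dbl) c))
  (≤-reflexive (sym (trans (∑-dbl f c) (∑-+ (f ∘ dbl) (f ∘ suc ∘ dbl) c))))

module _ {n′} (Q : Subset (suc n′)) (Q⊆V₁ : ∀ v → Q v ≡ true → inV1 v ≡ true) where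

  ext-even : Even n′ (ext Q)
  ext-even {i} {j} i≤ j≤ t = trans (cong₂ (λ a b → ev (a + b)) (sym (toℕ-clamp i≤)) (sym (toℕ-clamp j≤)))
    (trans (sym (inV1-ev (clamp i) (clamp j))) (Q⊆V₁ _ t))

  -- N(Q) is defined with Q removed; by parity no neighbour of Q is lost in this way.
  ext-adj : GridAdj n′ (ext Q) (ext (inN Q))
  ext-adj {i} {j} {i′} {j′} a i≤ j≤ i′≤ j′≤ t = inN⁺ Q (clamp i , clamp j) (clamp i′ , clamp j′) t notQ
      (subst₂ (λ x y → Adj x y _ _) (sym (toℕ-clamp i≤)) (sym (toℕ-clamp j≤))
        (subst₂ (λ x y → Adj _ _ x y) (sym (toℕ-clamp i′≤)) (sym (toℕ-clamp j′≤)) a))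
    where
    notQ : ext Q i′ j′ ≡ false
    notQ with ext Q i′ j′ in e
    ... | false = refl
    ... | true = true≢false (ext-even i′≤ j′≤ e) (trans (Adj-ev a) (cong not (ext-even i≤ j≤ t)))

lower-even : ∀ c′ (Q : Subset (dbl (suc c′))) → (∀ v → Q v ≡ true → inV1 v ≡ true) →
  let c = suc c′; p = card Q in
  ∃ λ g → p + g ≤ δ Q × (p ≤ g * g ⊎ c ≤ g ⊎ c * c + c * c ≤ p + (g * g + g))
lower-even c′ Q Q⊆V₁ = result
  where
  n′ = suc (dbl c′)
  c = suc c′
  Qₑ = ext Q
  Nₑ = ext (inN Q)
  g₁ = ext-adj Q Q⊆V₁
  g₂ = GridAdj-reflect {n′} {Qₑ} {Nₑ} g₁
  e₁ = ext-even Q Q⊆V₁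
  e₂ = Even-reflect {n′} {Qₑ} e₁
  Qᵣ = reflect n′ Qₑ
  Nᵣ = reflect n′ Nₑ
  p d : ℕ
  p = ∑ (D Qₑ ∘ dbl) c + ∑ (D Qᵣ ∘ dbl) c
  d = ∑ (D Nₑ ∘ suc ∘ dbl) c + ∑ (D Nᵣ ∘ suc ∘ dbl) c′
  p≡ : card Q ≡ p
  p≡ = trans (card-ext Q) (trans (Sq-diagonals Qₑ n′) (cong₂ _+_
    (∑-evens (D Qₑ) c (λ s s< → D-even {n′} {Qₑ} e₁ s (≤-pred s<)))
    (cong (_+ D Qᵣ (dbl c′)) (∑-evens (D Qᵣ) c′ (λ s s< → D-even {n′} {Qᵣ} e₂ s (≤-trans (<⇒≤ s<) (n≤1+n _)))))))
  d≤ : d ≤ δ Q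
  d≤ = ≤-trans (+-mono-≤ (∑-odds≤ (D Nₑ) c) (≤-trans (∑-odds≤ (D Nᵣ) c′) (m≤m+n _ (D Nᵣ (dbl c′)))))
    (≤-reflexive (sym (trans (card-ext (inN Q)) (Sq-diagonals Nₑ n′))))
  result : ∃ λ g → card Q + g ≤ δ Q × (card Q ≤ g * g ⊎ c ≤ g ⊎ c * c + c * c ≤ card Q + (g * g + g))
  result with profile-even (chain Qₑ Nₑ) (chain Qᵣ Nᵣ) c′
    (λ j le → grow-up {n′} {Qₑ} {Nₑ} g₁ (dbl j) (s≤s (dbl-mono le)))
    (λ j lt → grow-down {n′} {Qₑ} {Nₑ} g₁ (suc (dbl j)) (m≤n⇒m≤1+n (dbl-mono lt)))
    (λ j le → grow-up {n′} {Qᵣ} {Nᵣ} g₂ (dbl j) (s≤s (dbl-mono le)))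
    (λ j lt → grow-down {n′} {Qᵣ} {Nᵣ} g₂ (suc (dbl j)) (m≤n⇒m≤1+n (dbl-mono lt)))
    (D-reflect Nₑ n′)
  ... | g , eq , h rewrite p≡ = g , subst (_≤ δ Q) eq d≤ , h

lower-odd : ∀ c (Q : Subset (suc (dbl c))) → (∀ v → Q v ≡ true → inV1 v ≡ true) →
  let p = card Q in
  (∃ λ g → p + g ≤ δ Q × (p ≤ g * g ⊎ c ≤ g)) ⊎
  (∃ λ g → p + g ≤ suc (δ Q) × suc c * suc c + c * c ≤ p + g * g)
lower-odd c Q Q⊆V₁ = result
  where
  n′ = dbl c
  Qₑ = ext Q
  Nₑ = ext (inN Q)
  g₁ = ext-adj Q Q⊆V₁
  g₂ = GridAdj-reflect {n′} {Qₑ} {Nₑ} g₁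
  e₁ = ext-even Q Q⊆V₁
  e₂ = Even-reflect {n′} {Qₑ} e₁
  Qᵣ = reflect n′ Qₑ
  Nᵣ = reflect n′ Nₑ
  p d : ℕ
  p = ∑ (D Qₑ ∘ dbl) (suc c) + ∑ (D Qᵣ ∘ dbl) c
  d = ∑ (D Nₑ ∘ suc ∘ dbl) c + ∑ (D Nᵣ ∘ suc ∘ dbl) c
  p≡ : card Q ≡ p
  p≡ = trans (card-ext Q) (trans (Sq-diagonals Qₑ n′) (cong₂ _+_
    (cong (_+ D Qₑ n′) (∑-evens (D Qₑ) c (λ s s< → D-even {n′} {Qₑ} e₁ s (<⇒≤ s<))))
    (∑-evens (D Qᵣ) c (λ s s< → D-even {n′} {Qᵣ} e₂ s (<⇒≤ s<)))))
  d≤ : d ≤ δ Q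
  d≤ = ≤-trans (+-mono-≤ (≤-trans (∑-odds≤ (D Nₑ) c) (m≤m+n _ (D Nₑ n′))) (∑-odds≤ (D Nᵣ) c))
    (≤-reflexive (sym (trans (card-ext (inN Q)) (Sq-diagonals Nₑ n′))))
  result : (∃ λ g → card Q + g ≤ δ Q × (card Q ≤ g * g ⊎ c ≤ g)) ⊎
    (∃ λ g → card Q + g ≤ suc (δ Q) × suc c * suc c + c * c ≤ card Q + g * g)
  result with profile-odd (chain Qₑ Nₑ) (chain Qᵣ Nᵣ) c
    (λ j lt → grow-up {n′} {Qₑ} {Nₑ} g₁ (dbl j) (≤-trans (n≤1+n _) (dbl-mono lt)))
    (λ j lt → grow-down {n′} {Qₑ} {Nₑ} g₁ (suc (dbl j)) (dbl-mono lt))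
    (λ j lt → grow-up {n′} {Qᵣ} {Nᵣ} g₂ (dbl j) (≤-trans (n≤1+n _) (dbl-mono lt)))
    (λ j lt → grow-down {n′} {Qᵣ} {Nᵣ} g₂ (suc (dbl j)) (dbl-mono lt))
    (D-reflect Qₑ n′)
  ... | inj₁ (g , eq , h) rewrite p≡ = inj₁ (g , subst (_≤ δ Q) eq d≤ , h)
  ... | inj₂ (g , eq , h) rewrite p≡ = inj₂ (g , subst (_≤ suc (δ Q)) eq (s≤s d≤) , h)

-- Initial segments of the diagonal orderings

∈-take⁻ : ∀ {A : Set} {v : A} p xs → v ∈ take p xs → v ∈ xs
∈-take⁻ (suc p) (x ∷ xs) (here e) = here e
∈-take⁻ (suc p) (x ∷ xs) (there m) = there (∈-take⁻ p xs m)

∈-take⇒0< : ∀ {A : Set} {v : A} p xs → v ∈ take p xs → 0 < p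
∈-take⇒0< (suc p) xs m = s≤s z≤n

∈-take-++ : ∀ {A : Set} {v : A} p xs {ys} → v ∈ take p (xs ++ ys) →
  v ∈ take p xs ⊎ (∃ λ p′ → p ≡ length xs + p′ × v ∈ take p′ ys)
∈-take-++ p [] m = inj₂ (p , refl , m)
∈-take-++ (suc p) (x ∷ xs) (here e) = inj₁ (here e)
∈-take-++ (suc p) (x ∷ xs) (there m) with ∈-take-++ p xs m
... | inj₁ m′ = inj₁ (there m′)
... | inj₂ (p′ , e , m′) = inj₂ (p′ , cong suc e , m′)

-- Block lengths enter through lower bounds `h` on the blocks before k. They are quantified inside
-- the result, so `h` may be chosen after k is known.
∈-take-concatMap : ∀ {A B : Set} {v : B} (f : A → List B) (g : ℕ → A) p m →
  v ∈ take p (concatMap f (applyUpTo g m)) →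
  ∃₂ λ k p′ → k < m × v ∈ take p′ (f (g k)) ×
    (∀ h → (∀ l → l < k → h l ≤ length (f (g l))) → ∑ h k + p′ ≤ p)
∈-take-concatMap f g (suc p) zero ()
∈-take-concatMap f g p (suc m) v∈ with ∈-take-++ p (f (g 0)) v∈
... | inj₁ v∈₀ = 0 , p , s≤s z≤n , v∈₀ , λ _ _ → ≤-refl
... | inj₂ (p₁ , refl , v∈₁) with ∈-take-concatMap f (g ∘ suc) p₁ m v∈₁
... | k , p′ , k<m , v∈₂ , bound = suc k , p′ , s≤s k<m , v∈₂ , λ h h≤ →
  ≤-trans (≤-reflexive (trans (cong (_+ p′) (∑-front h k)) (+-assoc (h 0) _ p′)))
    (+-mono-≤ (h≤ 0 (s≤s z≤n)) (bound (h ∘ suc) (λ l l<k → h≤ (suc l) (s≤s l<k))))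

tabulate≡applyUpTo : ∀ {A : Set} {n} (f : Fin n → A) (g : ℕ → A) → (∀ i → f i ≡ g (toℕ i)) →
  tabulate f ≡ applyUpTo g n
tabulate≡applyUpTo {n = zero} f g e = refl
tabulate≡applyUpTo {n = suc n} f g e = cong₂ _∷_ (e Fin.zero) (tabulate≡applyUpTo (f ∘ Fin.suc) (g ∘ suc) (e ∘ Fin.suc))

fromList-∈ : ∀ {n} (xs : List (Vertex n)) v → fromList xs v ≡ true → v ∈ xs
fromList-∈ xs v e with find (any⁻ (λ u → u == v) xs (⇒T e))
... | (i , j) , u∈ , t with Equivalence.to (T-∧ {⌊ i ≟ᶠ proj₁ v ⌋}) t
... | t₁ , t₂ = subst (_∈ xs) (cong₂ _,_ (toWitness {a? = i ≟ᶠ proj₁ v} t₁) (toWitness {a? = j ≟ᶠ proj₂ v} t₂)) u∈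

∈⇒1≤length : ∀ {A : Set} {v : A} {xs} → v ∈ xs → 1 ≤ length xs
∈⇒1≤length {xs = _ ∷ _} _ = s≤s z≤n

-- The sum counts the rows before row j that a diagonal starting in row `lo` has already met.
∑-threshold : ∀ lo j → j ∸ lo ≤ ∑ (λ l → 𝟙 (lo ≤ᵇ l)) j
∑-threshold lo zero = ≤-reflexive (0∸n≡0 lo)
∑-threshold lo (suc j) with lo ≤ᵇ j in e
... | true = ≤-trans (≤-trans (suc∸≤ lo) (≤-reflexive (+-comm 1 (j ∸ lo)))) (+-monoˡ-≤ 1 (∑-threshold lo j))
  where
  suc∸≤ : ∀ lo → suc j ∸ lo ≤ suc (j ∸ lo)
  suc∸≤ lo = m≤n+o⇒m∸n≤o (suc j) lo (≤-trans (s≤s (m≤n+m∸n j lo)) (≤-reflexive (sym (+-suc lo (j ∸ lo)))))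
... | false = ≤-trans (≤-reflexive (m≤n⇒m∸n≡0 j<lo)) z≤n
  where
  j<lo : suc j ≤ lo
  j<lo = ≰⇒> (λ lo≤j → true≢false (T⇒ (≤⇒≤ᵇ lo≤j)) e)

-- The orderings Z and Z' differ by the reflection i ↦ n′ ∸ i of the first coordinate.
record Twist (n′ : ℕ) : Set where
  field
    ρ : ℕ → ℕ
    ρ≤ : ∀ {i} → i ≤ n′ → ρ i ≤ n′
    ρρ : ∀ {i} → i ≤ n′ → ρ (ρ i) ≡ i
    ρ-∑ : ∀ h → ∑ (h ∘ ρ) (suc n′) ≡ ∑ h (suc n′)
    ρ-Adj : ∀ {i j i′ j′} → i ≤ n′ → i′ ≤ n′ → Adj i j i′ j′ → Adj (ρ i) j (ρ i′) j′

id-twist : ∀ {n′} → Twist n′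
id-twist = record { ρ = id ; ρ≤ = id ; ρρ = λ _ → refl ; ρ-∑ = λ _ → refl ; ρ-Adj = λ _ _ a → a }

flip-twist : ∀ {n′} → Twist n′
flip-twist {n′} = record
  { ρ = n′ ∸_
  ; ρ≤ = λ {i} _ → m∸n≤m n′ i
  ; ρρ = m∸[m∸n]≡n
  ; ρ-∑ = λ h → sym (∑-rev h 0 (suc n′))
  ; ρ-Adj = Adj-flip
  }

-- Number of grid points with i + j ≡ s, for s ≤ n′ + n′.
len : ℕ → ℕ → ℕ
len n′ s = suc (s ⊓ (n′ + n′ ∸ s))

∑≥term : ∀ f n s → s < n → f s ≤ ∑ f n
∑≥term f (suc n) s (s≤s s≤n) with m≤n⇒m<n∨m≡n s≤n
... | inj₁ s<n = ≤-trans (∑≥term f n s s<n) (m≤m+n _ (f n))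
... | inj₂ refl = m≤n+m (f n) _

-- A single summand of `Sq-diagonals` gives the whole length: diagonal s if s ≤ n′, and the
-- reflected diagonal 2n′ - s otherwise.
Sq-diagonal≥ : ∀ n′ s → s ≤ n′ + n′ → len n′ s ≤ Sq (λ i j → i + j ≡ᵇ s) (suc n′)
Sq-diagonal≥ n′ s s≤ rewrite Sq-diagonals (λ i j → i + j ≡ᵇ s) n′ with s ≤? n′
... | yes s≤n′ = ≤-trans (s≤s (m⊓n≤m s (n′ + n′ ∸ s)))
  (≤-trans (≤-reflexive (sym (D-all f s (λ i j e → T⇒ (≡⇒≡ᵇ (i + j) s e)))))
    (≤-trans (∑≥term (D f) (suc n′) s (s≤s s≤n′)) (m≤m+n _ _)))
  where
  f : ℕ → ℕ → Bool
  f i j = i + j ≡ᵇ s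
... | no s≰n′ = ≤-trans (s≤s (m⊓n≤n s (n′ + n′ ∸ s)))
  (≤-trans (≤-reflexive (sym (D-all f* s* all)))
    (≤-trans (∑≥term (D f*) n′ s* s*<n′) (m≤n+m _ _)))
  where
  s* = n′ + n′ ∸ s
  f* : ℕ → ℕ → Bool
  f* = reflect n′ (λ i j → i + j ≡ᵇ s)
  s*+s : s* + s ≡ n′ + n′
  s*+s = m∸n+n≡m s≤
  s*<n′ : s* < n′
  s*<n′ = +-cancelʳ-< n′ s* n′ (≤-trans (+-monoʳ-< s* (≰⇒> s≰n′)) (≤-reflexive s*+s))
  lem : ∀ a b c d → a + b + (c + d) ≡ a + c + (b + d)
  lem = solve-∀
  all : ∀ i j → i + j ≡ s* → f* i j ≡ true
  all i j e = let (i≤ , j≤) = i≤i+j {i} {j} e (<⇒≤ s*<n′) in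
    T⇒ (≡⇒≡ᵇ _ s (+-cancelʳ-≡ s* ((n′ ∸ i) + (n′ ∸ j)) s
      (trans (cong ((n′ ∸ i) + (n′ ∸ j) +_) (sym e)) (trans (lem (n′ ∸ i) (n′ ∸ j) i j)
        (trans (cong₂ _+_ (m∸n+n≡m i≤) (m∸n+n≡m j≤)) (trans (sym s*+s) (+-comm s* s)))))))

module _ {n′} (tw : Twist n′) (P : Subset (suc n′)) (s : ℕ)
  (P≡ : ∀ i j → P (i , j) ≡ (Twist.ρ tw (toℕ i) + toℕ j ≡ᵇ s)) (s≤ : s ≤ n′ + n′) where
  open Twist tw

  length-diagonal : len n′ s ≤ length (filterᵇ P (vertices (suc n′)))
  length-diagonal = ≤-trans (Sq-diagonal≥ n′ s s≤) (≤-reflexive (sym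
    (trans (card-Sq P (λ i j → ρ i + j ≡ᵇ s) P≡)
      (∑-cong (suc n′) (λ j _ → ρ-∑ (λ i → 𝟙 (i + j ≡ᵇ s)))))))

  row-nonempty : ∀ l → l ≤ s → s ∸ n′ ≤ l → l ≤ n′ → 1 ≤ length (filterᵇ P (row {suc n′} (clamp l)))
  row-nonempty l l≤s lo≤l l≤n′ = ∈⇒1≤length (∈-filter⁺ (T? ∘ P) (∈-map⁺ (λ i → i , clamp l) (∈-allFin i)) (⇒T P-true))
    where
    x≤ : s ∸ l ≤ n′
    x≤ = m≤n+o⇒m∸n≤o s l (≤-trans (m≤n+m∸n s n′) (≤-trans (+-monoʳ-≤ n′ lo≤l) (≤-reflexive (+-comm n′ l))))
    i : Fin (suc n′)
    i = clamp (ρ (s ∸ l))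
    P-true : P (i , clamp l) ≡ true
    P-true = trans (P≡ i (clamp l)) (T⇒ (≡⇒≡ᵇ _ s
      (trans (cong₂ _+_ (trans (cong ρ (toℕ-clamp (ρ≤ x≤))) (ρρ x≤)) (toℕ-clamp l≤n′)) (m∸n+n≡m l≤s))))

  -- Diagonal s starts in row `s ∸ n′` and meets each later row up to its end, so `toℕ j ∸ (s ∸ n′)`
  -- is the zero-based position on it.
  ∈-take-diagonal : ∀ p i j → (i , j) ∈ take p (filterᵇ P (vertices (suc n′))) →
    ρ (toℕ i) + toℕ j ≡ s × toℕ j ∸ (s ∸ n′) < p
  ∈-take-diagonal p i j v∈ = key , result
    where
    key : ρ (toℕ i) + toℕ j ≡ s
    key = ≡ᵇ⇒≡ _ s (⇒T (trans (sym (P≡ i j)) (T⇒ (proj₂ (∈-filter⁻ (T? ∘ P) (∈-take⁻ p _ v∈))))))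
    v∈′ : (i , j) ∈ take p (concatMap (filterᵇ P ∘ row) (applyUpTo clamp (suc n′)))
    v∈′ = subst (λ xs → (i , j) ∈ take p xs)
      (trans (filterᵇ-concatMap P row (allFin (suc n′)))
        (cong (concatMap (filterᵇ P ∘ row)) (tabulate≡applyUpTo id clamp (λ i → sym (clamp-toℕ i))))) v∈
    result : toℕ j ∸ (s ∸ n′) < p
    result with ∈-take-concatMap (filterᵇ P ∘ row) clamp p (suc n′) v∈′
    ... | l , p′ , s≤s l≤n′ , v∈ₗ , bound with ∈-map⁻ (λ i → i , clamp l) (proj₁ (∈-filter⁻ (T? ∘ P) (∈-take⁻ p′ (filterᵇ P (row (clamp l))) v∈ₗ)))
    ... | _ , _ , refl rewrite toℕ-clamp l≤n′ =
      ≤-trans (s≤s (∑-threshold (s ∸ n′) l))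
        (≤-trans (≤-trans (≤-reflexive (+-comm 1 _)) (+-monoʳ-≤ _ (∈-take⇒0< p′ _ v∈ₗ))) (bound h h≤))
      where
      h : ℕ → ℕ
      h x = 𝟙 (s ∸ n′ ≤ᵇ x)
      h≤ : ∀ x → x < l → h x ≤ length (filterᵇ P (row (clamp x)))
      h≤ x x<l with s ∸ n′ ≤ᵇ x in e
      ... | false = z≤n
      ... | true = row-nonempty x (≤-trans (<⇒≤ x<l) (≤-trans (m≤n+m l (ρ (toℕ i))) (≤-reflexive (trans (cong (ρ (toℕ i) +_) (sym (toℕ-clamp l≤n′))) key))))
                     (≤ᵇ⇒≤ _ x (⇒T e)) (≤-trans (<⇒≤ x<l) l≤n′)

module _ {n′} (tw : Twist n′) (P : ℕ → Subset (suc n′)) (s : ℕ → ℕ) (m : ℕ)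
  (P≡ : ∀ k i j → P k (i , j) ≡ (Twist.ρ tw (toℕ i) + toℕ j ≡ᵇ s k)) (s≤ : ∀ k → k < m → s k ≤ n′ + n′) where
  open Twist tw

  prefix : ℕ → Subset (suc n′)
  prefix p = fromList (take p (concatMap (λ k → filterᵇ (P k) (vertices (suc n′))) (upTo m)))

  -- Membership bounds the position. This is the direction that an upper bound on δ uses, as it
  -- traces every boundary vertex back to some member.
  prefix-∈ : ∀ p i j → prefix p (i , j) ≡ true →
    ∃ λ k → ρ (toℕ i) + toℕ j ≡ s k × ∑ (len n′ ∘ s) k + (toℕ j ∸ (s k ∸ n′)) < p
  prefix-∈ p i j e
    with ∈-take-concatMap (λ k → filterᵇ (P k) (vertices (suc n′))) id p m (fromList-∈ _ (i , j) e)
  ... | k , p′ , k<m , v∈ , bound with ∈-take-diagonal tw (P k) (s k) (P≡ k) (s≤ k k<m) p′ i j v∈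
  ... | key , pos< = k , key ,
    ≤-trans (≤-reflexive (sym (+-suc (∑ (len n′ ∘ s) k) _))) (≤-trans (+-monoʳ-≤ (∑ (len n′ ∘ s) k) pos<)
      (bound (len n′ ∘ s) (λ l l<k → length-diagonal tw (P l) (s l) (P≡ l) (s≤ l (<-trans l<k k<m)))))

-- The boundary of an initial segment

same : Bool → Bool → Bool
same true b = b
same false b = not b

same-refl : ∀ b → same b b ≡ true
same-refl true = refl
same-refl false = refl

-- The most that a set living on parity `b` can have on an antidiagonal before or at the middle.
par : Bool → ℕ → ℕ
par b s = 𝟙 (same b (ev s)) * suc s

D≤par : ∀ b f s → (∀ i j → i + j ≡ s → f i j ≡ true → ev s ≡ b) → D f s ≤ par b s
D≤par b f s h with same b (ev s) in e
... | true = ≤-trans (D≤ f s) (≤-reflexive (sym (*-identityˡ (suc s))))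
... | false = ≤-reflexive (D-none f s none)
  where
  none : ∀ i j → i + j ≡ s → f i j ≡ false
  none i j ij with f i j in t
  ... | false = refl
  ... | true = true≢false (trans (cong (same b) (h i j ij t)) (same-refl b)) e

∑-mono : ∀ {f g} n → (∀ k → k < n → f k ≤ g k) → ∑ f n ≤ ∑ g n
∑-mono zero h = z≤n
∑-mono (suc n) h = +-mono-≤ (∑-mono n (λ k k<n → h k (m<n⇒m<1+n k<n))) (h n ≤-refl)

∑-zero : ∀ {f} n → (∀ k → k < n → f k ≡ 0) → ∑ f n ≡ 0
∑-zero zero h = refl
∑-zero (suc n) h = cong₂ _+_ (∑-zero n (λ k k<n → h k (m<n⇒m<1+n k<n))) (h n ≤-refl)

∑-tail : ∀ f a {n} → a ≤ n → (∀ k → a ≤ k → k < n → f k ≡ 0) → ∑ f n ≡ ∑ f a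
∑-tail f a {n} a≤n h with m≤n⇒m<n∨m≡n a≤n
... | inj₂ refl = refl
∑-tail f a {suc n} a≤n h | inj₁ (s≤s a≤n′) =
  trans (cong₂ _+_ (∑-tail f a a≤n′ (λ k le lt → h k le (m<n⇒m<1+n lt))) (h n a≤n′ ≤-refl)) (+-identityʳ _)

-- Stated without subtraction: f is at most g from e on, at most r on the one partly reached
-- diagonal e - 1, and zero before it.
∑-gap : ∀ f g r e {n} → e ≤ n → (∀ k → k < n → f k ≤ g k) →
  (∀ k → suc k < e → f k ≡ 0) → (∀ k → suc k ≡ e → f k ≤ r) → ∑ f n + ∑ g e ≤ ∑ g n + r
∑-gap f g r e {n} e≤n f≤g f0 fr with m≤n⇒m<n∨m≡n e≤n
∑-gap f g r zero {n} e≤n f≤g f0 fr | inj₂ refl = z≤n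
∑-gap f g r (suc e) {n} e≤n f≤g f0 fr | inj₂ refl =
  ≤-trans (+-monoˡ-≤ (∑ g (suc e)) (≤-trans (≤-reflexive (cong (_+ f e) (∑-zero e (λ k k<e → f0 k (s≤s k<e))))) (fr e refl)))
    (≤-reflexive (+-comm r _))
∑-gap f g r e {suc n} e≤n f≤g f0 fr | inj₁ (s≤s e≤n′) =
  ≤-trans (≤-reflexive (sw (∑ f n) (f n) (∑ g e)))
    (≤-trans (+-mono-≤ (∑-gap f g r e e≤n′ (λ k k<n → f≤g k (m<n⇒m<1+n k<n)) f0 fr) (f≤g n ≤-refl))
      (≤-reflexive (sw (∑ g n) r (g n))))
  where
  sw : ∀ a b c → a + b + c ≡ a + c + b
  sw = solve-∀

module _ {n′} (B : ℕ → ℕ → Bool) (b : Bool)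
  (B-ev : ∀ {i j} → i ≤ n′ → j ≤ n′ → B i j ≡ true → ev (i + j) ≡ b) where

  private
    B* = reflect n′ B

    D-B : ∀ s → s < suc n′ → D B s ≤ par b s
    D-B s (s≤s s≤n′) = D≤par b B s (λ i j e t → let (i≤ , j≤) = i≤i+j {i} {j} e s≤n′ in
      trans (cong ev (sym e)) (B-ev i≤ j≤ t))

    D-B* : ∀ s → s < n′ → D B* s ≤ par b s
    D-B* s s<n′ = D≤par b B* s (λ i j e t → let (i≤ , j≤) = i≤i+j {i} {j} e (<⇒≤ s<n′) in
      trans (cong ev (sym e)) (trans (sym (reflect-ev i≤ j≤)) (B-ev (m∸n≤m n′ i) (m∸n≤m n′ j) t)))

  Sq≤total : Sq B (suc n′) ≤ ∑ (par b) (suc n′) + ∑ (par b) n′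
  Sq≤total = ≤-trans (≤-reflexive (Sq-diagonals B n′)) (+-mono-≤ (∑-mono (suc n′) D-B) (∑-mono n′ D-B*))

  module _ {s₀} (B-≤ : ∀ {i j} → i ≤ n′ → j ≤ n′ → B i j ≡ true → i + j ≤ suc s₀) where
    private
      lem : ∀ a b c d → a + b + (c + d) ≡ a + c + (b + d)
      lem = solve-∀

      B*-none : ∀ s → s ≤ n′ → s + suc s₀ < n′ + n′ → D B* s ≡ 0
      B*-none s s≤n′ lt = D-none B* s none
        where
        none : ∀ i j → i + j ≡ s → B* i j ≡ false
        none i j refl with B* i j in t
        ... | false = refl
        ... | true = let (i≤ , j≤) = i≤i+j {i} {j} refl s≤n′ in contradiction
          (≤-trans (≤-reflexive (trans (cong₂ _+_ (sym (m+[n∸m]≡n i≤)) (sym (m+[n∸m]≡n j≤))) (lem i (n′ ∸ i) j (n′ ∸ j))))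
            (+-monoʳ-≤ (i + j) (B-≤ (m∸n≤m n′ i) (m∸n≤m n′ j) t)))
          (<⇒≱ lt)

    Sq≤lower : ∀ {r} → suc s₀ ≤ n′ → (∀ {i j} → i ≤ n′ → j ≤ n′ → i + j ≡ suc s₀ → B i j ≡ true → j < r) →
      Sq B (suc n′) ≤ ∑ (par b) (suc s₀) + r
    Sq≤lower {r} s₀<n′ front = ≤-trans (≤-reflexive (trans (Sq-diagonals B n′) (trans
        (cong₂ _+_ (∑-tail (D B) (suc (suc s₀)) (s≤s s₀<n′) none) (∑-zero n′ (λ s s<n′ → B*-none s (<⇒≤ s<n′) (+-mono-<-≤ s<n′ s₀<n′))))
        (+-identityʳ _))))
      (+-mono-≤ (∑-mono (suc s₀) (λ s s< → D-B s (≤-trans s< (m≤n⇒m≤1+n s₀<n′))))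
        (D≤-col B (suc s₀) r (λ i j e t → let (i≤ , j≤) = i≤i+j {i} {j} e s₀<n′ in front i≤ j≤ e t)))
      where
      none : ∀ s → suc (suc s₀) ≤ s → s < suc n′ → D B s ≡ 0
      none s lt (s≤s s≤n′) = D-none B s none′
        where
        none′ : ∀ i j → i + j ≡ s → B i j ≡ false
        none′ i j refl with B i j in t
        ... | false = refl
        ... | true = let (i≤ , j≤) = i≤i+j {i} {j} refl s≤n′ in contradiction (B-≤ i≤ j≤ t) (<⇒≱ lt)

    -- Seen from the opposite corner, the front diagonal s₀ + 1 has index e - 1, and B has no points
    -- nearer to that corner.
    Sq≤upper : ∀ {r e} → e + s₀ ≡ n′ + n′ → e ≤ n′ →
      (∀ {i j} → i ≤ n′ → j ≤ n′ → i + j ≡ suc s₀ → B i j ≡ true → n′ ∸ i < r) →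
      Sq B (suc n′) + ∑ (par b) e ≤ ∑ (par b) (suc n′) + ∑ (par b) n′ + r
    Sq≤upper {r} {e} e+s₀ e≤n′ front = ≤-trans (≤-reflexive (trans (cong (_+ ∑ (par b) e) (Sq-diagonals B n′)) (+-assoc (∑ (D B) (suc n′)) _ _)))
      (≤-trans (+-mono-≤ (∑-mono (suc n′) D-B) (∑-gap (D B*) (par b) r e e≤n′ D-B* gap edge))
        (≤-reflexive (sym (+-assoc (∑ (par b) (suc n′)) _ _))))
      where
      gap : ∀ s → suc s < e → D B* s ≡ 0
      gap s lt = B*-none s (≤-trans (<⇒≤ (<-trans ≤-refl lt)) e≤n′)
        (≤-trans (≤-reflexive (sym (+-suc s (suc s₀)))) (≤-trans (≤-reflexive (lem′ s s₀)) (≤-trans (+-monoˡ-≤ s₀ lt) (≤-reflexive e+s₀))))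
        where
        lem′ : ∀ s t → s + suc (suc t) ≡ suc (suc s) + t
        lem′ = solve-∀
      edge : ∀ s → suc s ≡ e → D B* s ≤ r
      edge s refl = D≤-row B* s r bound
        where
        bound : ∀ i j → i + j ≡ s → B* i j ≡ true → i < r
        bound i j ij t = let (i≤ , j≤) = i≤i+j {i} {j} ij (<⇒≤ e≤n′) in
          subst (_< r) (m∸[m∸n]≡n i≤) (front (m∸n≤m n′ i) (m∸n≤m n′ j)
            (+-cancelˡ-≡ (i + j) _ _ (trans (lem i j (n′ ∸ i) (n′ ∸ j))
              (trans (cong₂ _+_ (m+[n∸m]≡n i≤) (m+[n∸m]≡n j≤)) (trans (sym e+s₀)
                (trans (sym (+-suc s s₀)) (cong (_+ suc s₀) (sym ij))))))) t)

Adj-key≤ : ∀ {i j i′ j′} → Adj i j i′ j′ → i′ + j′ ≤ suc (i + j)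
Adj-key≤ right = ≤-refl
Adj-key≤ left = ≤-trans (n≤1+n _) (n≤1+n _)
Adj-key≤ (up {i} {j}) = ≤-reflexive (+-suc i j)
Adj-key≤ (down {i} {j}) = ≤-trans (≤-trans (n≤1+n _) (≤-reflexive (sym (+-suc i j)))) (n≤1+n _)

Adj-forward : ∀ {i j i′ j′} → Adj i j i′ j′ → i′ + j′ ≡ suc (i + j) → i ≤ i′ × j′ ≤ suc j
Adj-forward right _ = n≤1+n _ , n≤1+n _
Adj-forward up _ = ≤-refl , ≤-refl
Adj-forward (left {i} {j}) e = contradiction (≤-reflexive (sym e)) (<⇒≱ (≤-trans ≤-refl (n≤1+n _)))
Adj-forward (down {i} {j}) e = contradiction (≤-trans (≤-reflexive (cong suc (sym (+-suc i j)))) (≤-reflexive (sym e))) (<⇒≱ (≤-trans ≤-refl (n≤1+n _)))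

module _ {n′} (tw : Twist n′) (s : ℕ → ℕ)
  (s-mono : ∀ {k l} → k < l → s k < s l) (b : Bool) (s-ev : ∀ k → ev (s k) ≡ not b) (p : ℕ)
  (S : Subset (suc n′))
  (S-∈ : ∀ i j → S (i , j) ≡ true →
    ∃ λ k → Twist.ρ tw (toℕ i) + toℕ j ≡ s k × ∑ (len n′ ∘ s) k + (toℕ j ∸ (s k ∸ n′)) < p) where
  open Twist tw

  private
    -- The boundary in twisted coordinates, where S is filled along the antidiagonals i + j = s k.
    B : ℕ → ℕ → Bool
    B i j = ext (inN S) (ρ i) j

    δ≡ : δ S ≡ Sq B (suc n′)
    δ≡ = trans (card-ext (inN S)) (∑-cong (suc n′) (λ j _ → sym (ρ-∑ (λ i → 𝟙 (ext (inN S) i j)))))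

    neighbour : ∀ {i j} → i ≤ n′ → j ≤ n′ → B i j ≡ true →
      ∃ λ k → ∃₂ λ i′ j′ → Adj i′ j′ i j × i′ ≤ n′ × i′ + j′ ≡ s k × ∑ (len n′ ∘ s) k + (j′ ∸ (s k ∸ n′)) < p
    neighbour {i} {j} i≤ j≤ t with inN⁻ S (clamp (ρ i) , clamp j) t
    ... | (a , c) , Su , adj with S-∈ a c Su
    ... | k , key , lt = k , ρ (toℕ a) , toℕ c ,
      subst₂ (Adj (ρ (toℕ a)) (toℕ c)) (trans (cong ρ (toℕ-clamp (ρ≤ i≤))) (ρρ i≤)) (toℕ-clamp j≤)
        (ρ-Adj (toℕ≤pred[n] a) (toℕ≤pred[n] (clamp (ρ i))) adj) ,
      ρ≤ (toℕ≤pred[n] a) , key , lt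

    B-ev : ∀ {i j} → i ≤ n′ → j ≤ n′ → B i j ≡ true → ev (i + j) ≡ b
    B-ev i≤ j≤ t with neighbour i≤ j≤ t
    ... | k , i′ , j′ , adj , _ , key , _ = trans (Adj-ev adj) (trans (cong not (trans (cong ev key) (s-ev k))) (not-involutive b))

    ∑-len-mono : ∀ {k l} → k ≤ l → ∑ (len n′ ∘ s) k ≤ ∑ (len n′ ∘ s) l
    ∑-len-mono {k} {l} k≤l with ∃+ k≤l
    ... | d , refl = ≤-trans (m≤m+n _ _) (≤-reflexive (sym (∑-rev (len n′ ∘ s) k d)))

  δ-total : δ S ≤ ∑ (par b) (suc n′) + ∑ (par b) n′
  δ-total = ≤-trans (≤-reflexive δ≡) (Sq≤total B b B-ev)

  δ-empty : p ≡ 0 → δ S ≡ 0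
  δ-empty refl = trans δ≡ (∑-zero (suc n′) (λ j j< → ∑-zero (suc n′) (λ i i< → cong 𝟙 (none i< j<))))
    where
    none : ∀ {i j} → i < suc n′ → j < suc n′ → B i j ≡ false
    none {i} {j} (s≤s i≤) (s≤s j≤) with B i j in t
    ... | false = refl
    ... | true with neighbour i≤ j≤ t
    ... | _ , _ , _ , _ , _ , _ , ()

  module _ {k₀ r} (p≡ : p ≡ ∑ (len n′ ∘ s) k₀ + r) (r≤ : r ≤ len n′ (s k₀)) where
    private
      key≤ : ∀ {k x} → ∑ (len n′ ∘ s) k + x < p → k < k₀ ⊎ (k ≡ k₀ × x < r)
      key≤ {k} {x} lt with <-cmp k k₀
      ... | tri< k<k₀ _ _ = inj₁ k<k₀
      ... | tri≈ _ refl _ = inj₂ (refl , +-cancelˡ-< (∑ (len n′ ∘ s) k) x r (≤-trans lt (≤-reflexive p≡)))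
      ... | tri> _ _ k₀<k = contradiction (≤-trans (≤-reflexive p≡) (≤-trans (+-monoʳ-≤ (∑ (len n′ ∘ s) k₀) r≤)
              (≤-trans (∑-len-mono k₀<k) (m≤m+n _ x)))) (<⇒≱ lt)

      sk≤ : ∀ {k x} → k < k₀ ⊎ (k ≡ k₀ × x < r) → s k ≤ s k₀
      sk≤ (inj₁ lt) = <⇒≤ (s-mono lt)
      sk≤ (inj₂ (refl , _)) = ≤-refl

      B-≤ : ∀ {i j} → i ≤ n′ → j ≤ n′ → B i j ≡ true → i + j ≤ suc (s k₀)
      B-≤ i≤ j≤ t with neighbour i≤ j≤ t
      ... | k , i′ , j′ , adj , _ , key , lt = ≤-trans (Adj-key≤ adj) (s≤s (≤-trans (≤-reflexive key) (sk≤ (key≤ lt))))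

      front : ∀ {i j} → i ≤ n′ → j ≤ n′ → i + j ≡ suc (s k₀) → B i j ≡ true →
        ∃₂ λ i′ j′ → i′ ≤ i × j ≤ suc j′ × i′ ≤ n′ × i′ + j′ ≡ s k₀ × j′ ∸ (s k₀ ∸ n′) < r
      front i≤ j≤ e t with neighbour i≤ j≤ t
      ... | k , i′ , j′ , adj , i′≤ , key , lt with key≤ lt
      ... | inj₁ k<k₀ = contradiction (≤-trans (≤-reflexive (sym e)) (Adj-key≤ adj))
                          (<⇒≱ (s≤s (≤-trans (s≤s (≤-reflexive key)) (s-mono k<k₀))))
      ... | inj₂ (refl , pos<) with Adj-forward adj (trans e (cong suc (sym key)))
      ... | i′≤i , j≤ = i′ , j′ , i′≤i , j≤ , i′≤ , key , pos<

    -- Before the middle the r filled vertices have j < r, so their forward neighbours have j ≤ r: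
    -- one more than r.
    δ-lower : suc (s k₀) ≤ n′ → δ S ≤ ∑ (par b) (suc (s k₀)) + suc r
    δ-lower lt = ≤-trans (≤-reflexive δ≡) (Sq≤lower B b B-ev B-≤ lt col)
      where
      col : ∀ {i j} → i ≤ n′ → j ≤ n′ → i + j ≡ suc (s k₀) → B i j ≡ true → j < suc r
      col i≤ j≤ e t with front i≤ j≤ e t
      ... | _ , j′ , _ , j≤′ , _ , _ , pos< = ≤-trans (s≤s j≤′) (s≤s (subst (λ z → j′ ∸ z < r) (m≤n⇒m∸n≡0 (<⇒≤ lt)) pos<))

    -- From the middle on, filling starts at the edge i = n′, where the step right leaves the grid,
    -- so there are at most r forward neighbours. In coordinates, the position j′ - (s k₀ - n′)
    -- equals n′ - i′.
    δ-upper : ∀ {e} → n′ ≤ s k₀ → e + s k₀ ≡ n′ + n′ → δ S + ∑ (par b) e ≤ ∑ (par b) (suc n′) + ∑ (par b) n′ + r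
    δ-upper {e} n′≤ e+ = ≤-trans (≤-reflexive (cong (_+ ∑ (par b) e) δ≡))
      (Sq≤upper B b B-ev B-≤ e+ (+-cancelʳ-≤ n′ e n′ (≤-trans (+-monoʳ-≤ e n′≤) (≤-reflexive e+))) row′)
      where
      row′ : ∀ {i j} → i ≤ n′ → j ≤ n′ → i + j ≡ suc (s k₀) → B i j ≡ true → n′ ∸ i < r
      row′ {i} i≤ j≤ e t with front i≤ j≤ e t
      ... | i′ , j′ , i′≤i , _ , i′≤ , key , pos< = ≤-<-trans (∸-monoʳ-≤ n′ i′≤i) (≤-<-trans pos≥ pos<)
        where
        x = s k₀ ∸ n′
        pos≥ : n′ ∸ i′ ≤ j′ ∸ x
        pos≥ = m+n≤o⇒m≤o∸n (n′ ∸ i′) (+-cancelˡ-≤ i′ _ _ (≤-reflexive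
          (trans (sym (+-assoc i′ (n′ ∸ i′) x)) (trans (cong (_+ x) (m+[n∸m]≡n i′≤)) (trans (m+[n∸m]≡n n′≤) (sym key))))))

-- Explicit bounds for the boundary of `Z`

∑-par-false : ∀ k → ∑ (par false) (dbl k) ≡ k * k + k
∑-par-false k = trans (∑-dbl (par false) k) (trans (∑-cong k step) (∑-even k))
  where
  step : ∀ j → j < k → par false (dbl j) + par false (suc (dbl j)) ≡ suc (suc (dbl j))
  step j _ rewrite ev-dbl j = +-identityʳ _

∑-par-false′ : ∀ k → ∑ (par false) (suc (dbl k)) ≡ k * k + k
∑-par-false′ k rewrite ev-dbl k = trans (+-identityʳ _) (∑-par-false k)

∑-par-true : ∀ k → ∑ (par true) (dbl k) ≡ k * k
∑-par-true k = trans (∑-dbl (par true) k) (trans (∑-cong k step) (∑-odd k))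
  where
  step : ∀ j → j < k → par true (dbl j) + par true (suc (dbl j)) ≡ suc (dbl j)
  step j _ rewrite ev-dbl j = trans (+-identityʳ _) (+-identityʳ _)

∑-par-true′ : ∀ k → ∑ (par true) (suc (dbl k)) ≡ suc k * suc k
∑-par-true′ k rewrite ev-dbl k = trans (cong₂ _+_ (∑-par-true k) (trans (+-identityʳ _) (cong suc (dbl≡ k)))) (lem k)
  where
  lem : ∀ k → k * k + suc (k + k) ≡ suc k * suc k
  lem = solve-∀

len-low : ∀ {n′ s} → s ≤ n′ → len n′ s ≡ suc s
len-low {n′} {s} s≤ = cong suc (m≤n⇒m⊓n≡m (m+n≤o⇒m≤o∸n s (+-mono-≤ s≤ s≤)))

len-high : ∀ {n′ s e} → n′ ≤ s → e + s ≡ n′ + n′ → len n′ s ≡ suc e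
len-high {n′} {s} {e} n′≤ eq = cong suc (trans (cong (s ⊓_) e≡)
  (m≥n⇒m⊓n≡n (≤-trans (+-cancelʳ-≤ n′ e n′ (≤-trans (+-monoʳ-≤ e n′≤) (≤-reflexive eq))) n′≤)))
  where
  e≡ : n′ + n′ ∸ s ≡ e
  e≡ = trans (cong (_∸ s) (sym eq)) (m+n∸n≡m e s)

locate : ∀ h K {p} → p < ∑ h K → ∃₂ λ k r → k < K × r < h k × p ≡ ∑ h k + r
locate h (suc K) {p} p< with p <? ∑ h K
... | yes lt with locate h K lt
... | k , r , k<K , r< , eq = k , r , m<n⇒m<1+n k<K , r< , eq
locate h (suc K) {p} p< | no ge with ∃+ (≮⇒≥ ge)
... | r , eq = K , r , ≤-refl , +-cancelˡ-< (∑ h K) r (h K) (subst (_< ∑ h K + h K) eq p<) , eq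

dbl-+ : ∀ a b → dbl (a + b) ≡ dbl a + dbl b
dbl-+ zero b = refl
dbl-+ (suc a) b = cong (suc ∘ suc) (dbl-+ a b)

sq-mono : ∀ {a b} → a ≤ b → a * a ≤ b * b
sq-mono le = *-mono-≤ le le

sq-cancel-< : ∀ {a b} → a * a < b * b → a < b
sq-cancel-< lt = ≰⇒> (λ b≤a → <⇒≱ lt (sq-mono b≤a))

suc-sq : ∀ i → suc i * suc i ≡ i * i + suc (i + i)
suc-sq = solve-∀

-- i₀ + 1 is the number of even diagonals from the middle on, and x the excess of |V₁| over |V₂|.
module ZBound (n′ c i₀ x : ℕ) (2n′≡ : n′ + n′ ≡ dbl (c + i₀))
  (low : ∀ {k} → k < c → suc (dbl k) ≤ n′) (high : ∀ {k} → c ≤ k → n′ ≤ dbl k)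
  (x≤1 : x ≤ 1) (c+x : suc i₀ ≡ c + x)
  (V≡ : ∑ (par false) (suc n′) + ∑ (par false) n′ + x ≡ c * c + suc i₀ * suc i₀) where

  N V : ℕ
  N = c * c + suc i₀ * suc i₀
  V = ∑ (par false) (suc n′) + ∑ (par false) n′

  h : ℕ → ℕ
  h k = len n′ (dbl k)

  h-low : ∀ {k} → k < c → h k ≡ suc (dbl k)
  h-low k<c = len-low (<⇒≤ (low k<c))

  -- With `k + i ≡ c + i₀`, i is the number of even diagonals behind the k-th.
  codiag : ∀ {k i} → k + i ≡ c + i₀ → dbl i + dbl k ≡ n′ + n′
  codiag {k} {i} e = trans (sym (dbl-+ i k)) (trans (cong dbl (trans (+-comm i k) e)) (sym 2n′≡))

  h-high : ∀ {k i} → c ≤ k → k + i ≡ c + i₀ → h k ≡ suc (dbl i)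
  h-high {k} {i} c≤k e = len-high (high c≤k) (codiag {k} {i} e)

  ∑h-low : ∀ {k} → k ≤ c → ∑ h k ≡ k * k
  ∑h-low {k} k≤c = trans (∑-cong k (λ j j<k → h-low (≤-trans j<k k≤c))) (∑-odd k)

  ∑h-high : ∀ d {i} → c + d + i ≡ c + i₀ → ∑ h (c + d) + suc i * suc i ≡ N
  ∑h-high zero {i} e = cong₂ (λ a b → a + suc b * suc b)
    (trans (cong (∑ h) (+-identityʳ c)) (∑h-low ≤-refl))
    (+-cancelˡ-≡ c i i₀ (trans (cong (_+ i) (sym (+-identityʳ c))) e))
  ∑h-high (suc d) {i} e rewrite +-suc c d = trans (cong (λ z → ∑ h (c + d) + z + suc i * suc i)
      (trans (h-high (m≤m+n c d) e′) (cong suc (dbl≡ (suc i)))))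
    (trans (lem (∑ h (c + d)) i) (∑h-high d e′))
    where
    e′ : c + d + suc i ≡ c + i₀
    e′ = trans (+-suc (c + d) i) e
    lem : ∀ t i → t + suc (suc i + suc i) + suc i * suc i ≡ t + suc (suc i) * suc (suc i)
    lem = solve-∀

  ∑h-total : ∑ h (suc (c + i₀)) ≡ N
  ∑h-total = trans (cong (∑ h (c + i₀) +_) (h-high (m≤m+n c i₀) (+-identityʳ _))) (∑h-high i₀ (+-identityʳ _))

  module _ (p : ℕ) (S : Subset (suc n′))
    (S-∈ : ∀ i j → S (i , j) ≡ true →
      ∃ λ k → toℕ i + toℕ j ≡ dbl k × ∑ (len n′ ∘ dbl) k + (toℕ j ∸ (dbl k ∸ n′)) < p) where

    private
      dbl-mono-< : ∀ {k l} → k < l → dbl k < dbl l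
      dbl-mono-< k<l = ≤-trans (s≤s (n≤1+n _)) (dbl-mono k<l)

      d = δ S

      total : d ≤ V
      total = δ-total id-twist dbl dbl-mono-< false ev-dbl p S S-∈

      lower : ∀ {k r} → p ≡ ∑ h k + r → r ≤ h k → k < c → d ≤ p + suc k
      lower {k} {r} p≡ r≤ k<c = ≤-trans (δ-lower id-twist dbl dbl-mono-< false ev-dbl p S S-∈ p≡ r≤ (low k<c))
        (≤-reflexive (trans (cong (_+ suc r) (∑-par-false′ k))
          (trans (lem (k * k) k r) (cong (_+ suc k) (sym (trans p≡ (cong (_+ r) (∑h-low (<⇒≤ k<c)))))))))
        where
        lem : ∀ q k r → q + k + suc r ≡ q + r + suc k
        lem = solve-∀

      -- V₁ has (i + 1)² - r vertices left unfilled, and at least i² + i - r vertices of V₂ are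
      -- unreached. The difference i + 1, corrected by x, is the surplus.
      upper : ∀ {k r} → p ≡ ∑ h k + r → r ≤ h k → c ≤ k → k ≤ c + i₀ →
        ∃ λ i → k + i ≡ c + i₀ × p + suc i * suc i ≡ N + r × d + x ≤ p + suc i
      upper {k} {r} p≡ r≤ c≤k k≤ with ∃+ k≤ | ∃+ c≤k
      ... | i , e | y , refl = i , sym e , p-sq , +-cancelʳ-≤ (i * i + i) _ _ (begin
          d + x + (i * i + i) ≡⟨ sw d x (i * i + i) ⟩
          d + (i * i + i) + x ≤⟨ +-monoˡ-≤ x (subst (λ z → d + z ≤ V + r) (∑-par-false i)
                                  (δ-upper id-twist dbl dbl-mono-< false ev-dbl p S S-∈ p≡ r≤ (high c≤k) (codiag {c + y} {i} (sym e)))) ⟩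
          V + r + x ≡⟨ sw V r x ⟩
          V + x + r ≡⟨ cong (_+ r) V≡ ⟩
          N + r ≡⟨ sym p-sq ⟩
          p + suc i * suc i ≡⟨ lem p i ⟩
          p + suc i + (i * i + i) ∎)
        where
        open ≤-Reasoning
        sw : ∀ a b c → a + b + c ≡ a + c + b
        sw = solve-∀
        lem : ∀ p i → p + suc i * suc i ≡ p + suc i + (i * i + i)
        lem = solve-∀
        p-sq : p + suc i * suc i ≡ N + r
        p-sq = trans (cong (_+ suc i * suc i) p≡) (trans (sw (∑ h (c + y)) r (suc i * suc i)) (cong (_+ r) (∑h-high y (sym e))))

      d+x≤p : N ≤ p → d + x ≤ p
      d+x≤p N≤p = ≤-trans (+-monoˡ-≤ x total) (≤-trans (≤-reflexive V≡) N≤p)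

      cases : 0 < p → p < N ⊎ N ≤ p → (∃ λ k → k < c × k * k < p × d ≤ p + suc k) ⊎ (c * c < p × d ≤ p + c) ⊎ d ≤ p
      cases 0<p (inj₂ N≤p) = inj₂ (inj₂ (≤-trans (m≤m+n d x) (d+x≤p N≤p)))
      -- Locating p - 1 keeps a just completed diagonal as the frontier instead of opening an empty
      -- one. This gives k² < p strictly, and at p = (k + 1)² the surplus k + 1 rather than k + 2.
      cases (s≤s {n = p₁} z≤n) (inj₁ p<N) with locate h (suc (c + i₀)) {p₁} (≤-trans (<⇒≤ p<N) (≤-reflexive (sym ∑h-total)))
      ... | k , r , s≤s k≤ , r< , eq with k <? c
      ...   | yes k<c = inj₁ (k , k<c , k²<p , lower p≡ r< k<c)
        where
        p≡ : p ≡ ∑ h k + suc r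
        p≡ = trans (cong suc eq) (sym (+-suc (∑ h k) r))
        k²<p : k * k < p
        k²<p = s≤s (≤-trans (≤-reflexive (sym (∑h-low (<⇒≤ k<c)))) (≤-trans (m≤m+n _ r) (≤-reflexive (sym eq))))
      ...   | no k≮c with upper {k} (trans (cong suc eq) (sym (+-suc (∑ h k) r))) r< (≮⇒≥ k≮c) k≤
      ...     | i , e , _ , d≤ = inj₂ (inj₁ (c²<p , +-cancelʳ-≤ x d (p + c)
                  (≤-trans d≤ (≤-trans (+-monoʳ-≤ p (≤-trans (s≤s i≤i₀) (≤-reflexive c+x))) (≤-reflexive (sym (+-assoc p c x)))))))
        where
        i≤i₀ : i ≤ i₀
        i≤i₀ = +-cancelˡ-≤ c i i₀ (≤-trans (+-monoˡ-≤ i (≮⇒≥ k≮c)) (≤-reflexive e))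
        ∑h-mono : ∀ {a b} → a ≤ b → ∑ h a ≤ ∑ h b
        ∑h-mono {a} le with ∃+ le
        ... | y , refl = ≤-trans (m≤m+n _ _) (≤-reflexive (sym (∑-rev h a y)))
        c²<p : c * c < p
        c²<p = s≤s (≤-trans (≤-reflexive (sym (∑h-low ≤-refl))) (≤-trans (∑h-mono (≮⇒≥ k≮c))
                 (≤-trans (m≤m+n _ r) (≤-reflexive (sym eq)))))

      d-empty : p ≡ 0 → d ≡ 0
      d-empty = δ-empty id-twist dbl dbl-mono-< false ev-dbl p S S-∈

    δ≤p+c : d ≤ p + c
    δ≤p+c with p ≟ 0
    ... | yes p≡0 = ≤-trans (≤-reflexive (d-empty p≡0)) z≤n
    ... | no p≢0 with cases (n≢0⇒n>0 p≢0) (swap (≤-<-connex N p))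
    ...   | inj₁ (k , k<c , _ , d≤) = ≤-trans d≤ (+-monoʳ-≤ p k<c)
    ...   | inj₂ (inj₁ (_ , d≤)) = d≤
    ...   | inj₂ (inj₂ d≤) = ≤-trans d≤ (m≤m+n p c)

    δ≤p+g : ∀ g → p ≤ g * g ⊎ c ≤ g → d ≤ p + g
    δ≤p+g g (inj₂ c≤g) = ≤-trans δ≤p+c (+-monoʳ-≤ p c≤g)
    δ≤p+g g (inj₁ p≤g²) with p ≟ 0
    ... | yes p≡0 = ≤-trans (≤-reflexive (d-empty p≡0)) z≤n
    ... | no p≢0 with cases (n≢0⇒n>0 p≢0) (swap (≤-<-connex N p))
    ...   | inj₁ (k , k<c , k²<p , d≤) = ≤-trans d≤ (+-monoʳ-≤ p (sq-cancel-< (≤-trans k²<p p≤g²)))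
    ...   | inj₂ (inj₁ (c²<p , d≤)) = ≤-trans d≤ (+-monoʳ-≤ p (<⇒≤ (sq-cancel-< (≤-trans c²<p p≤g²))))
    ...   | inj₂ (inj₂ d≤) = ≤-trans d≤ (m≤m+n p g)

    -- With the frontier at or past the middle and i diagonals behind it, more than i² vertices of
    -- V₁ are missing. As at most g² are missing, i < g.
    δ+x≤p+g : ∀ g → N ≤ p + g * g → d + x ≤ p + g
    δ+x≤p+g g N≤ with c <? g
    ... | yes c<g = ≤-trans (+-mono-≤ δ≤p+c x≤1) (≤-trans (≤-reflexive (trans (+-assoc p c 1) (cong (p +_) (+-comm c 1)))) (+-monoʳ-≤ p c<g))
    ... | no c≮g with p <? N
    ...   | no p≮N = ≤-trans (d+x≤p (≮⇒≥ p≮N)) (m≤m+n p g)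
    -- Here p itself is located: in the shrinking half an empty new frontier gives the better bound,
    -- and r ≤ 2i follows.
    ...   | yes p<N with locate h (suc (c + i₀)) {p} (≤-trans p<N (≤-reflexive (sym ∑h-total)))
    ...     | k , r , s≤s k≤ , r< , eq with k <? c
    ...       | yes k<c = contradiction (≤-trans N≤ (+-monoʳ-≤ p (≤-trans (sq-mono (≮⇒≥ c≮g)) (sq-mono c≤suci₀))))
                            (<⇒≱ (+-monoˡ-< (suc i₀ * suc i₀) p<c²))
      where
      c≤suci₀ : c ≤ suc i₀
      c≤suci₀ = ≤-trans (m≤m+n c x) (≤-reflexive (sym c+x))
      p<c² : p < c * c
      p<c² = ≤-trans (s≤s (≤-reflexive eq)) (≤-trans (≤-reflexive (sym (+-suc (∑ h k) r)))
        (≤-trans (+-mono-≤ (≤-reflexive (∑h-low (<⇒≤ k<c))) r<)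
          (≤-trans (≤-reflexive (trans (cong (k * k +_) (trans (h-low k<c) (cong suc (dbl≡ k)))) (sym (suc-sq k)))) (sq-mono k<c))))
    ...       | no k≮c with upper {k} eq (<⇒≤ r<) (≮⇒≥ k≮c) k≤
    ...         | i , e , p-sq , d≤ = ≤-trans d≤ (+-monoʳ-≤ p (sq-cancel-< i²<g²))
      where
      r≤ : r ≤ i + i
      r≤ = ≤-pred (≤-trans r< (≤-reflexive (trans (h-high (≮⇒≥ k≮c) e) (cong suc (dbl≡ i)))))
      i²<g² : i * i < g * g
      i²<g² = +-cancelˡ-≤ p _ _ (+-cancelʳ-≤ (i + i) _ _ (begin
        p + suc (i * i) + (i + i) ≡⟨ lem p i ⟩
        p + suc i * suc i ≡⟨ p-sq ⟩
        N + r ≤⟨ +-mono-≤ N≤ r≤ ⟩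
        p + g * g + (i + i) ∎))
        where
        open ≤-Reasoning
        lem : ∀ p i → p + suc (i * i) + (i + i) ≡ p + suc i * suc i
        lem = solve-∀

-- The orderings as sequences of diagonals, and the boundary of `Z'` for even n

2*≡dbl : ∀ k → 2 * k ≡ dbl k
2*≡dbl k = trans (cong (k +_) (+-identityʳ k)) (sym (dbl≡ k))

≡ᵇ-cong : ∀ {a b c d} → (a ≡ b → c ≡ d) → (c ≡ d → a ≡ b) → (a ≡ᵇ b) ≡ (c ≡ᵇ d)
≡ᵇ-cong {a} {b} {c} {d} f g with a ≡ᵇ b in e₁ | c ≡ᵇ d in e₂
... | true | true = refl
... | false | false = refl
... | true | false = true≢false (T⇒ (≡⇒≡ᵇ c d (f (≡ᵇ⇒≡ a b (⇒T e₁))))) e₂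
... | false | true = true≢false (T⇒ (≡⇒≡ᵇ a b (g (≡ᵇ⇒≡ c d (⇒T e₂))))) e₁

Z-∈ : ∀ n′ p (i j : Fin (suc n′)) → Z (suc n′) p (i , j) ≡ true →
  ∃ λ k → toℕ i + toℕ j ≡ dbl k × ∑ (len n′ ∘ dbl) k + (toℕ j ∸ (dbl k ∸ n′)) < p
Z-∈ n′ p = prefix-∈ id-twist (λ k v → (xc v + yc v) ≡ᵇ (2 * suc k)) dbl (suc n′)
  (λ k i j → cong₂ _≡ᵇ_ (cong suc (+-suc (toℕ i) (toℕ j))) (2*≡dbl (suc k)))
  (λ { k (s≤s k≤) → ≤-trans (dbl-mono k≤) (≤-reflexive (dbl≡ n′)) }) p

ceilHalf-dbl : ∀ c → ceilHalf (dbl c) ≡ c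
ceilHalf-dbl zero = refl
ceilHalf-dbl (suc c) = trans (m/n≡1+[m∸n]/n {suc (suc (dbl c + 1))} {2} (s≤s (s≤s z≤n))) (cong suc (ceilHalf-dbl c))

-- For even n the flip changes parity: x - y = n - 2 - 2k becomes (n′ - i) + j = 2k + 1, so V₁
-- occupies the odd diagonals.
Z′-∈ : ∀ c′ p → let n′ = suc (dbl c′) in (i j : Fin (suc n′)) → Z' (suc n′) p (i , j) ≡ true →
  ∃ λ k → n′ ∸ toℕ i + toℕ j ≡ suc (dbl k) × ∑ (len n′ ∘ suc ∘ dbl) k + (toℕ j ∸ (suc (dbl k) ∸ n′)) < p
Z′-∈ c′ p = prefix-∈ flip-twist (λ k v → (xc v + 2 * k + 2) ≡ᵇ (yc v + 2 * ceilHalf (suc n′))) (suc ∘ dbl)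
  (2 * ceilHalf (suc n′) ∸ 1) P≡ s≤ p
  where
  n′ = suc (dbl c′)
  2C≡ : 2 * ceilHalf (suc n′) ≡ suc n′
  2C≡ = trans (cong (2 *_) (ceilHalf-dbl (suc c′))) (2*≡dbl (suc c′))
  P≡ : ∀ k (i j : Fin (suc n′)) → ((suc (toℕ i) + 2 * k + 2) ≡ᵇ (suc (toℕ j) + 2 * ceilHalf (suc n′))) ≡
    ((n′ ∸ toℕ i) + toℕ j ≡ᵇ suc (dbl k))
  P≡ k i j = trans (cong₂ _≡ᵇ_ (cong (λ z → suc (toℕ i) + z + 2) (2*≡dbl k)) (cong (suc (toℕ j) +_) 2C≡)) (≡ᵇ-cong to from)
    where
    a = toℕ i
    b = toℕ j
    y = n′ ∸ a
    n′≡ : n′ ≡ a + y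
    n′≡ = sym (m+[n∸m]≡n (toℕ≤pred[n] i))
    l₁ : ∀ a y b → suc b + suc (a + y) ≡ suc (suc a) + (y + b)
    l₁ = solve-∀
    l₂ : ∀ a k → suc a + k + 2 ≡ suc (suc a) + suc k
    l₂ = solve-∀
    to : suc a + dbl k + 2 ≡ suc b + suc n′ → y + b ≡ suc (dbl k)
    to e = sym (+-cancelˡ-≡ (suc (suc a)) _ _ (trans (sym (l₂ a (dbl k))) (trans e (trans (cong (λ z → suc b + suc z) n′≡) (l₁ a y b)))))
    from : y + b ≡ suc (dbl k) → suc a + dbl k + 2 ≡ suc b + suc n′
    from e = trans (l₂ a (dbl k)) (trans (cong (suc (suc a) +_) (sym e)) (trans (sym (l₁ a y b)) (cong (λ z → suc b + suc z) (sym n′≡))))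
  s≤ : ∀ k → k < 2 * ceilHalf (suc n′) ∸ 1 → suc (dbl k) ≤ n′ + n′
  s≤ k k< = ≤-trans (≤-trans (n≤1+n _) (dbl-mono (subst (λ z → k < z ∸ 1) 2C≡ k<))) (≤-reflexive (dbl≡ n′))

module Z′Bound (c′ : ℕ) where
  private
    c n′ N : ℕ
    c = suc c′
    n′ = suc (dbl c′)
    N = c * c + c * c

    s h : ℕ → ℕ
    s = suc ∘ dbl
    h k = len n′ (s k)

    N≡ : N ≡ c * c + c + (c′ * c′ + c′)
    N≡ = lem c′
      where
      lem : ∀ x → suc x * suc x + suc x * suc x ≡ suc x * suc x + suc x + (x * x + x)
      lem = solve-∀

    ∑h-low : ∑ h c ≡ c * c + c
    ∑h-low = trans (∑-cong c (λ { k (s≤s k≤c′) → len-low (s≤s (dbl-mono k≤c′)) })) (∑-even c)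

    codiag : ∀ {k i} → k + suc i ≡ c′ + c → suc (dbl i) + s k ≡ n′ + n′
    codiag {k} {i} e = cong suc (trans (+-suc (dbl i) (dbl k))
      (suc-injective (trans (trans (cong (suc ∘ suc) (sym (dbl-+ i k))) (cong dbl (trans (+-comm (suc i) k) e)))
        (trans (dbl-+ c′ c) (+-suc (dbl c′) _)))))

    h-high : ∀ {k i} → c ≤ k → k + suc i ≡ c′ + c → h k ≡ suc (suc (dbl i))
    h-high {k} {i} c≤k e = len-high (≤-trans (≤-trans (n≤1+n _) (dbl-mono c≤k)) (n≤1+n _)) (codiag {k} {i} e)

    ∑h-high : ∀ d {e} → c + d + e ≡ c′ + c → ∑ h (c + d) + (e * e + e) ≡ N
    ∑h-high zero {e} eq = trans (cong₂ (λ a b → a + (b * b + b))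
      (trans (cong (∑ h) (+-identityʳ c)) ∑h-low)
      (+-cancelˡ-≡ c e c′ (trans (cong (_+ e) (sym (+-identityʳ c))) (trans eq (+-comm c′ c))))) (sym N≡)
    ∑h-high (suc d) {e} eq rewrite +-suc c′ d = trans (cong (λ z → ∑ h (c + d) + z + (e * e + e))
        (trans (h-high (m≤m+n c d) eq′) (cong (suc ∘ suc) (dbl≡ e))))
      (trans (lem (∑ h (c + d)) e) (∑h-high d eq′))
      where
      eq′ : c + d + suc e ≡ c′ + c
      eq′ = trans (+-suc (c + d) e) eq
      lem : ∀ t e → t + suc (suc (e + e)) + (e * e + e) ≡ t + (suc e * suc e + suc e)
      lem = solve-∀

    ∑h-total : ∑ h (c + c′) ≡ N
    ∑h-total = trans (sym (+-identityʳ _)) (∑h-high c′ (trans (+-identityʳ _) (+-comm c c′)))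

    s-mono : ∀ {k l} → k < l → s k < s l
    s-mono k<l = s≤s (≤-trans (s≤s (n≤1+n _)) (dbl-mono k<l))

  module _ (p : ℕ) where
    private
      S = Z' (suc n′) p
      d = δ S

      total : d ≤ N
      total = ≤-trans (δ-total flip-twist s s-mono true ev-suc-dbl p S (Z′-∈ c′ p))
        (≤-reflexive (cong₂ _+_ (∑-par-true c) (∑-par-true′ c′)))

      upper : ∀ {k i r} → p ≡ ∑ h k + r → r ≤ h k → c ≤ k → k + suc i ≡ c′ + c →
        p + (suc i * suc i + suc i) ≡ N + r × d ≤ p + suc i
      upper {k} {i} {r} p≡ r≤ c≤k e with ∃+ c≤k
      ... | y , refl = p-sq , +-cancelʳ-≤ (suc i * suc i) _ _ (begin
          d + suc i * suc i ≤⟨ subst₂ (λ u v → d + u ≤ v + r) (∑-par-true′ i) (cong₂ _+_ (∑-par-true c) (∑-par-true′ c′))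
            (δ-upper flip-twist s s-mono true ev-suc-dbl p S (Z′-∈ c′ p) p≡ r≤
              (≤-trans (≤-trans (n≤1+n _) (dbl-mono c≤k)) (n≤1+n _)) (codiag {c + y} {i} e)) ⟩
          N + r ≡⟨ sym p-sq ⟩
          p + (suc i * suc i + suc i) ≡⟨ cong (p +_) (+-comm (suc i * suc i) (suc i)) ⟩
          p + (suc i + suc i * suc i) ≡⟨ sym (+-assoc p (suc i) _) ⟩
          p + suc i + suc i * suc i ∎)
        where
        open ≤-Reasoning
        sw : ∀ a b c → a + b + c ≡ a + c + b
        sw = solve-∀
        p-sq : p + (suc i * suc i + suc i) ≡ N + r
        p-sq = trans (cong (_+ (suc i * suc i + suc i)) p≡) (trans (sw (∑ h (c + y)) r _) (cong (_+ r) (∑h-high y e)))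

    -- Oblong numbers replace squares: the i diagonals behind the frontier have sizes 2, 4, ..., 2i,
    -- so more than i² + i vertices are missing and i < g. The assumption g < c excludes a frontier
    -- in the growing half.
    δ′≤p+g : ∀ g → g < c → N ≤ p + (g * g + g) → d ≤ p + g
    δ′≤p+g g (s≤s g≤c′) N≤ with p <? N
    ... | no p≮N = ≤-trans total (≤-trans (≮⇒≥ p≮N) (m≤m+n p g))
    ... | yes p<N with locate h (c + c′) {p} (≤-trans p<N (≤-reflexive (sym ∑h-total)))
    ...   | k , r , k< , r< , eq with k <? c
    ...     | yes k<c = contradiction p≥ (<⇒≱ p<c²+c)
      where
      p≥ : c * c + c ≤ p
      p≥ = +-cancelʳ-≤ (c′ * c′ + c′) _ _ (≤-trans (≤-reflexive (sym N≡))
             (≤-trans N≤ (+-monoʳ-≤ p (+-mono-≤ (sq-mono g≤c′) g≤c′))))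
      p<c²+c : p < c * c + c
      p<c²+c with ∃+ k<c
      ... | y , e = ≤-trans (s≤s (≤-reflexive eq)) (≤-trans (≤-reflexive (sym (+-suc (∑ h k) r))) (≤-trans (+-monoʳ-≤ (∑ h k) r<)
             (≤-trans (m≤m+n _ _) (≤-reflexive (trans (sym (∑-rev h (suc k) y)) (trans (cong (∑ h) (sym e)) ∑h-low))))))
    ...     | no k≮c with ∃+ k<
    ...       | i , e = ≤-trans (proj₂ tail-bound) (+-monoʳ-≤ p (≰⇒> (λ g≤i → <⇒≱ i<g (+-mono-≤ (sq-mono g≤i) g≤i))))
      where
      e′ : k + suc i ≡ c′ + c
      e′ = trans (+-suc k i) (trans (sym e) (+-comm c c′))
      tail-bound : p + (suc i * suc i + suc i) ≡ N + r × d ≤ p + suc i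
      tail-bound = upper {k} {i} eq (<⇒≤ r<) (≮⇒≥ k≮c) e′
      r≤ : r ≤ suc (i + i)
      r≤ = ≤-pred (≤-trans r< (≤-reflexive (trans (h-high (≮⇒≥ k≮c) e′) (cong (suc ∘ suc) (dbl≡ i)))))
      i<g : i * i + i < g * g + g
      i<g = +-cancelˡ-≤ p _ _ (+-cancelʳ-≤ (suc (i + i)) _ _ (begin
        p + suc (i * i + i) + suc (i + i) ≡⟨ lem p i ⟩
        p + (suc i * suc i + suc i) ≡⟨ proj₁ tail-bound ⟩
        N + r ≤⟨ +-mono-≤ N≤ r≤ ⟩
        p + (g * g + g) + suc (i + i) ∎))
        where
        open ≤-Reasoning
        lem : ∀ p i → p + suc (i * i + i) + suc (i + i) ≡ p + (suc i * suc i + suc i)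
        lem = solve-∀

-- Assembly by the parity of n

even-or-odd : ∀ n → ∃ λ c → n ≡ dbl c ⊎ n ≡ suc (dbl c)
even-or-odd zero = 0 , inj₁ refl
even-or-odd (suc n) with even-or-odd n
... | c , inj₁ e = c , inj₂ (cong suc e)
... | c , inj₂ e = suc c , inj₁ (cong suc e)

consecutive-oblongs : ∀ x → suc x * suc x + suc x + (x * x + x) ≡ suc x * suc x + suc x * suc x
consecutive-oblongs = solve-∀

equal-oblongs : ∀ x → x * x + x + (x * x + x) + 1 ≡ x * x + suc x * suc x
equal-oblongs = solve-∀

module ZEven (c′ : ℕ) = ZBound (suc (dbl c′)) (suc c′) c′ 0
  (cong suc (trans (+-suc (dbl c′) (dbl c′)) (cong suc (sym (dbl-+ c′ c′)))))
  (λ k< → s≤s (dbl-mono (≤-pred k<)))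
  (λ c≤k → ≤-trans (n≤1+n _) (dbl-mono c≤k))
  z≤n (sym (+-identityʳ _))
  (trans (+-identityʳ _) (trans (cong₂ _+_ (∑-par-false (suc c′)) (∑-par-false′ c′)) (consecutive-oblongs c′)))

module ZOdd (c : ℕ) = ZBound (dbl c) c c 1
  (sym (dbl-+ c c))
  (λ k<c → ≤-trans (n≤1+n _) (dbl-mono k<c))
  dbl-mono
  ≤-refl (+-comm 1 c)
  (trans (cong₂ (λ a b → a + b + 1) (∑-par-false′ c) (∑-par-false c)) (equal-oblongs c))

theorem9 : (n : ℕ) (Q : Subset n) →
    (∀ v → Q v ≡ true → inV1 v ≡ true) →
    δ (Z n (card Q)) ⊓ δ (Z' n (card Q)) ≤ δ Q
theorem9 n Q Q⊆V₁ with even-or-odd n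
... | zero , inj₁ refl = z≤n
... | suc c′ , inj₁ refl with lower-even c′ Q Q⊆V₁
...   | g , p+g≤ , inj₁ p≤g² = m≤n⇒m⊓o≤n _ (≤-trans (ZEven.δ≤p+g c′ (card Q) _ (Z-∈ _ (card Q)) g (inj₁ p≤g²)) p+g≤)
...   | g , p+g≤ , inj₂ (inj₁ c≤g) = m≤n⇒m⊓o≤n _ (≤-trans (ZEven.δ≤p+g c′ (card Q) _ (Z-∈ _ (card Q)) g (inj₂ c≤g)) p+g≤)
...   | g , p+g≤ , inj₂ (inj₂ N≤) with g <? suc c′
...     | yes g<c = m≤n⇒o⊓m≤n _ (≤-trans (Z′Bound.δ′≤p+g c′ (card Q) g g<c N≤) p+g≤)
-- For g ≥ c the general bound p + c for `Z` is enough.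
...     | no g≮c = m≤n⇒m⊓o≤n _ (≤-trans (ZEven.δ≤p+g c′ (card Q) _ (Z-∈ _ (card Q)) g (inj₂ (≮⇒≥ g≮c))) p+g≤)
theorem9 n Q Q⊆V₁ | c , inj₂ refl with lower-odd c Q Q⊆V₁
...   | inj₁ (g , p+g≤ , h) = m≤n⇒m⊓o≤n _ (≤-trans (ZOdd.δ≤p+g c (card Q) _ (Z-∈ _ (card Q)) g h) p+g≤)
-- g is the surplus plus one; x = 1 supplies the matching unit on the side of `Z`, and both are
-- cancelled.
...   | inj₂ (g , p+g≤ , N≤) = m≤n⇒m⊓o≤n _ (+-cancelʳ-≤ 1 _ _
  (≤-trans (ZOdd.δ+x≤p+g c (card Q) _ (Z-∈ _ (card Q)) g (≤-trans (≤-reflexive (+-comm (c * c) _)) N≤))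
    (≤-trans p+g≤ (≤-reflexive (+-comm 1 _)))))
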